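{- For every integer $n\ge 1$ the following identities hold: (i) $\tau(n) = \frac{5\cdot 691}{9504}\sigma(n) - \frac{(6n-5)\cdot 691}{864} \sigma_9(n) + \frac{2275}{1584}\sigma_{11}(n) - \frac{5\cdot 691}{36} \sum^{n-1}_{m=1}\sigma(m)\sigma_9(n-m)$; (ii) $\tau(n) = \frac{15}{32}n\sigma(n)-\frac{33}{32}n\sigma_9(n)+\frac{50}{32}n^2\sigma_7(n) +225 \sum^{n-1}_{m=1}m\sigma(m)\sigma_7(n-m)$; (iii) $\tau(n) = \frac{6}{7}n^2\sigma(n) -\frac{9}{7}n^3\sigma_5(n) +\frac{10}{7}n^2\sigma_7(n) -24\cdot 18 \sum^{n-1}_{m=1}m^2\sigma(m)\sigma_5(n-m)$; (iv) $\tau(n) = \frac{14}{5}n^3\sigma(n)+\frac{12}{5}n^4\sigma_3(n)-\frac{21}{5}n^3\sigma_5(n) + 24\cdot 28 \sum^{n-1}_{m=1}m^3\sigma(m)\sigma_3(n-m)$; (v) $\tau(n) = \frac{5}{12}n\sigma(n)+\frac{25}{24}n\sigma_7(n)-\frac{11}{24}n\sigma_9(n) +25\sum^{n-1}_{m=1}(9m-n)\sigma(m)\sigma_7(n-m)$; (vi) $\tau(n) = \frac{9}{14}n^2\sigma(n)+\frac{5}{14}n^2\sigma_7(n) -108 \sum^{n-1}_{m=1}(4m^2-mn)\sigma(m)\sigma_5(n-m)$; (vii) $\tau(n) = \frac{8}{5}n^3\sigma(n)-\frac{3}{5}n^3\sigma_5(n) +96 \sum^{n-1}_{m=1}(7m^3-3m^2n)\sigma(m)\sigma_3(n-m)$;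 (viii) $\tau(n) = \frac{1}{2}n^2\sigma(n) + \frac{1}{2}n^2\sigma_5(n) - 12 \sum^{n-1}_{m=1}(36m^2-16 mn +n^2)\sigma(m)\sigma_5(n-m)$; (ix) $\tau(n) = n^3\sigma(n)- 24 \sum^{n-1}_{m=1}(21m^2n-28m^3-3mn^2)\sigma(m)\sigma_3(n-m)$.
   Context: $\tau(n)$ is Ramanujan's tau function, defined by $q\prod_{n\ge 1}(1-q^n)^{24} = \sum_{n\ge 1}\tau(n)q^n$. For $k\ge 1$, $\sigma_k(n)=\sum_{d\mid n} d^k$ (sum over positive divisors of $n$), and $\sigma(n)=\sigma_1(n)$. For $n=1$ the sum $\sum_{m=1}^{n-1}$ is empty and equals $0$. -}

module Defs where

open import Agda.Builtin.FromNat using (Number)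
open import Data.Bool using (if_then_else_)
open import Data.Fin using (toℕ)
open import Data.Integer as ℤ using (ℤ; +_; 0ℤ; 1ℤ)
import Data.Integer.Properties as ℤ
open import Data.List using (List; map; filter; upTo)
open import Data.Nat using (ℕ; zero; suc; _^_; _∸_; _≡ᵇ_)
open import Data.Nat.Divisibility using (_∣?_)
open import Data.Nat.ListAction using (sum)
import Data.Nat.Literals as ℕ-Literals
open import Data.Rational using (ℚ)
import Data.Rational.Literals as ℚ-Literals
import Data.Rational.Properties as ℚ
open import Algebra.Bundles using (CommutativeRing)
import Algebra.Properties.Semiring.Sum as SemiringSum

module ∑ℤ = SemiringSum (CommutativeRing.semiring ℤ.+-*-commutativeRing)
module ∑ℚ = SemiringSum (CommutativeRing.semiring ℚ.+-*-commutativeRing)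

instance
  ℕ-number : Number ℕ
  ℕ-number = ℕ-Literals.number

  ℚ-number : Number ℚ
  ℚ-number = ℚ-Literals.number

infix 9 ↑_

↑_ : ℕ → ℚ
↑ n = ℚ-Literals.fromℤ (+ n)

divisors : ℕ → List ℕ
divisors n = filter (_∣? n) (map suc (upTo n))

σ : ℕ → ℕ → ℕ
σ k n = sum (map (_^ k) (divisors n))

sum₁₋ : ℕ → (ℕ → ℚ) → ℚ
sum₁₋ n f = ∑ℚ.sum {n ∸ 1} (λ i → f (suc (toℕ i)))

syntax sum₁₋ n (λ m → e) = ∑[1≤ m < n ] e

-- Formal power series in q with integer coefficients; f n is the coefficient
-- of qⁿ.
PowerSeries : Set
PowerSeries = ℕ → ℤ

infixl 7 _⊛_
infixl 6 _⊖_
infixr 8 _^ˢ_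

_⊖_ : PowerSeries → PowerSeries → PowerSeries
(f ⊖ g) n = f n ℤ.- g n

_⊛_ : PowerSeries → PowerSeries → PowerSeries
(f ⊛ g) n = ∑ℤ.sum {suc n} (λ i → f (toℕ i) ℤ.* g (n ∸ toℕ i))

q^_ : ℕ → PowerSeries
(q^ k) n = if n ≡ᵇ k then 1ℤ else 0ℤ

one : PowerSeries
one = q^ 0

_^ˢ_ : PowerSeries → ℕ → PowerSeries
f ^ˢ zero  = one
f ^ˢ suc k = f ⊛ f ^ˢ k

partialProduct : ℕ → PowerSeries
partialProduct zero    = one
partialProduct (suc N) = partialProduct N ⊛ (one ⊖ q^ (suc N)) ^ˢ 24

-- ∏_{k ≥ 1} (1 - qᵏ)²⁴.  The factors with k > n are 1 modulo qⁿ⁺¹, so the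
-- coefficient of qⁿ in the infinite product is already that of the product
-- over 1 ≤ k ≤ n.
infiniteProduct : PowerSeries
infiniteProduct n = partialProduct n n

τ : ℕ → ℤ
τ = q^ 1 ⊛ infiniteProduct

{-# OPTIONS --safe #-}
-- Put S_k = ∑ σ_k(n) qⁿ and u_x = q^x / (1 - q^x), so that S_k = ∑ x^k u_x.  Then
-- u_x u_y = u_{x+y} (u_x + u_y + 1).  Multiplying by a kernel h with
-- h(x , y - x) = h(x - y , y) and summing over x and y, the first two terms become sums of
-- h(x , y - x) u_x u_y over x < y and over x > y (Skoruppa).  Hence h(x , y) - h(x , y - x) yields
-- a linear relation between the products S_i S_j, the S_k, and the derivative coming from the
-- diagonal x u_x² = D u_x - x u_x, where D = q d/dq.  For the kernels N, N², N³ with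
-- N = x² + xy + y² these are Ramanujan's differential equations for S₁, S₃, S₅; for J, NJ, N²J with
-- J = (xy(x + y))² they express S₇, S₉, S₁₁ through S₃ and S₅.
--
-- Logarithmic differentiation of the product gives D τ = (1 - 24 S₁) τ.  By Ramanujan's equations
-- (E₄³ - E₆²) / 1728 satisfies the same equation, so the two agree.  Each of the nine identities is
-- thereby an identity between polynomials in S₁, S₃, S₅.
module Submission where

open import Defs
open import Algebra.Bundles using (CommutativeRing)
open import Algebra.Solver.Ring.AlmostCommutativeRing using (fromCommutativeRing; _-Raw-AlmostCommutative⟶_; -raw-almostCommutative⟶)
open import Data.Bool using (Bool; true; false; T; if_then_else_)
open import Data.Empty using (⊥-elim)
open import Data.Fin using (Fin; zero; suc; toℕ)
open import Data.Fin.Patterns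
open import Data.Integer as ℤ using (ℤ; 1ℤ)
import Data.Integer.Properties as ℤ
import Data.Integer.Solver as ℤ
open import Data.List as List using (List; []; _∷_; applyUpTo; filter)
import Data.List.Properties as List
open import Data.Maybe using (Maybe; just; is-just; map)
open import Data.Nat as ℕ using (ℕ; zero; suc; z≤n; s≤s; _≤_; _<_; _∸_; _^_; _≡ᵇ_)
open import Data.Nat.Divisibility using (_∣?_; _∣0; ∣m+n∣m⇒∣n; ∣m∣n⇒∣m+n; ∣-refl; >⇒∤)
open import Data.Nat.Induction using (<-rec)
open import Data.Nat.ListAction using (sum)
import Data.Nat.Properties as ℕ
open import Data.Product using (_×_; _,_)
open import Data.Rational using (ℚ; _+_; _-_; _*_; _÷_; -_; 1/_; 0ℚ; 1ℚ; _≟_)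
open import Data.Rational.Literals using (fromℤ)
open import Data.Rational.Properties as ℚ using (+-assoc; +-comm; +-identityˡ; +-identityʳ; *-assoc; *-comm; *-identityˡ; *-identityʳ; *-distribˡ-+; *-distribʳ-+; *-zeroˡ; *-zeroʳ)
import Data.Rational.Unnormalised.Properties as ℚᵘ
import Data.Rational.Unnormalised as ℚᵘ
open import Data.Vec as Vec using (Vec; []; _∷_; lookup)
import Data.Vec.Properties as Vec
open import Function using (_∘_; flip)
open import Level using (0ℓ)
open import Relation.Binary.PropositionalEquality
open import Relation.Nullary.Decidable using (Dec; yes; no; does; dec⇒maybe)
open import Algebra.Properties.Semiring.Exp (CommutativeRing.semiring ℚ.+-*-commutativeRing) using () renaming (_^_ to _^ℚ_)

-- The kernels come from the triple (x , y , -x - y): N is minus its second elementary symmetric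
-- function, and J is the square of the third. Both are even. The triples of (x , y - x) and (x - y
-- , y) are (x , y - x , -y) and (x - y , y , -x), negatives of each other up to order, so every
-- polynomial in N and J satisfies the condition on h. The triple of (x , -y) is also (x , y - x ,
-- -y) up to order. Hence h(x , y) - h(x , y - x) = h(x , y) - h(x , -y) is twice the part of h odd
-- in y. As h contains only even degrees, only products S_i S_j with i and j odd arise. Multiples of
-- J vanish at y = 0, so their diagonal gives no derivative; being divisible by x² y², they have an
-- odd part divisible by x³ y³, so S₁ does not occur. All sums over x and y are finite at a fixed
-- coefficient, because u_x starts at q^x. The remaining work is to recognise polynomials with
-- rational coefficients as equal, which is left to evaluation of normal forms.

module Polynomials (R : CommutativeRing 0ℓ 0ℓ)
  (φ : CommutativeRing.rawRing ℚ.+-*-commutativeRing -Raw-AlmostCommutative⟶ fromCommutativeRing R) where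

  private module R = CommutativeRing R
  open _-Raw-AlmostCommutative⟶_ φ using () renaming (⟦_⟧ to φ⟦_⟧)

  coefficient-≟ : ∀ a b → Maybe (φ⟦ a ⟧ R.≈ φ⟦ b ⟧)
  coefficient-≟ a b = map (λ a≡b → R.reflexive (cong φ⟦_⟧ a≡b)) (dec⇒maybe (a ≟ b))

  open import Algebra.Solver.Ring (CommutativeRing.rawRing ℚ.+-*-commutativeRing) (fromCommutativeRing R) φ coefficient-≟ public

  _≟ᴺ_ : ∀ {n} → Polynomial n → Polynomial n → Bool
  p ≟ᴺ q = is-just (normalise p ≟N normalise q)

  -- For closed `p` and `q` the premise evaluates to the unit type and is filled in automatically.
  -- This decides identities between polynomials that are themselves computed, by `substitute`, `∂`
  -- or `form`.
  identity : ∀ {n} (p q : Polynomial n) → T (p ≟ᴺ q) → ∀ ρ → ⟦ p ⟧ ρ R.≈ ⟦ q ⟧ ρ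
  identity p q _ ρ with normalise p ≟N normalise q
  ... | just eq = R.trans (R.sym (correct p ρ)) (R.trans (⟦ eq ⟧N-cong ρ) (correct q ρ))

module Rat = Polynomials ℚ.+-*-commutativeRing (-raw-almostCommutative⟶ (fromCommutativeRing ℚ.+-*-commutativeRing))

-- Finite sums and formal power series

-- Opaque, because unification cannot recover the summand from an unfolded sum
opaque
  ∑ : ℕ → (ℕ → ℚ) → ℚ
  ∑ n f = ∑ℚ.sum {n} (f ∘ toℕ)

  Λ : (ℕ → ℕ → ℚ) → ℕ → ℚ
  Λ F n = ∑ (suc n) (λ i → F i (n ∸ i))

opaque
  unfolding ∑ Λ

  ∑-cong : ∀ n {f g : ℕ → ℚ} → (∀ i → i < n → f i ≡ g i) → ∑ n f ≡ ∑ n g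
  ∑-cong zero    eq = refl
  ∑-cong (suc n) eq = cong₂ _+_ (eq 0 (s≤s z≤n)) (∑-cong n λ i i<n → eq (suc i) (s≤s i<n))

  ∑-zero : ∀ n {f : ℕ → ℚ} → (∀ i → i < n → f i ≡ 0ℚ) → ∑ n f ≡ 0ℚ
  ∑-zero n eq = trans (∑-cong n eq) (∑ℚ.sum-replicate-zero n)

  ∑-+ : ∀ n (f g : ℕ → ℚ) → ∑ n (λ i → f i + g i) ≡ ∑ n f + ∑ n g
  ∑-+ n f g = ∑ℚ.∑-distrib-+ {n} (f ∘ toℕ) (g ∘ toℕ)

  ∑-*ˡ : ∀ n c (f : ℕ → ℚ) → c * ∑ n f ≡ ∑ n (λ i → c * f i)
  ∑-*ˡ n c f = ∑ℚ.*-distribˡ-sum {n} c (f ∘ toℕ)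

  ∑-comm : ∀ m n (f : ℕ → ℕ → ℚ) → ∑ m (λ i → ∑ n (f i)) ≡ ∑ n (λ j → ∑ m (λ i → f i j))
  ∑-comm m n f = ∑ℚ.∑-comm {m} {n} (λ i j → f (toℕ i) (toℕ j))

  ∑-last : ∀ n (f : ℕ → ℚ) → ∑ (suc n) f ≡ ∑ n f + f n
  ∑-last zero    f = +-comm (f 0) 0ℚ
  ∑-last (suc n) f = trans (cong (f 0 +_) (∑-last n (f ∘ suc))) (sym (+-assoc (f 0) _ _))

  ∑-0 : ∀ f → ∑ 0 f ≡ 0ℚ
  ∑-0 f = refl

  ∑-truncate : ∀ {m n} f → m ≤ n → (∀ i → m ≤ i → f i ≡ 0ℚ) → ∑ n f ≡ ∑ m f
  ∑-truncate {n = n} f z≤n       eq = ∑-zero n λ i _ → eq i z≤n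
  ∑-truncate         f (s≤s m≤n) eq = cong (f 0 +_) (∑-truncate (f ∘ suc) m≤n λ i m≤i → eq (suc i) (s≤s m≤i))

  Λ-∑ : ∀ m n (F : ℕ → ℕ → ℕ → ℚ) → Λ (λ i j → ∑ m (λ x → F x i j)) n ≡ ∑ m (λ x → Λ (F x) n)
  Λ-∑ m n F = ∑-comm (suc n) m (λ i x → F x i (n ∸ i))

  -- The two indices arrive with the equation `i + j ≡ n`; matching it with `refl` keeps truncated
  -- subtraction out of all later arguments.
  Λ-cong : ∀ n {F G : ℕ → ℕ → ℚ} → (∀ i j → i ℕ.+ j ≡ n → F i j ≡ G i j) → Λ F n ≡ Λ G n
  Λ-cong n eq = ∑-cong (suc n) λ { i (s≤s i≤n) → eq i (n ∸ i) (ℕ.m+[n∸m]≡n i≤n) }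

  Λ-0 : ∀ F → Λ F 0 ≡ F 0 0
  Λ-0 F = +-identityʳ (F 0 0)

  Λ-suc : ∀ n F → Λ F (suc n) ≡ F 0 (suc n) + Λ (F ∘ suc) n
  Λ-suc n F = refl

  Λ-zero : ∀ n {F : ℕ → ℕ → ℚ} → (∀ i j → i ℕ.+ j ≡ n → F i j ≡ 0ℚ) → Λ F n ≡ 0ℚ
  Λ-zero n eq = trans (Λ-cong n eq) (∑-zero (suc n) λ _ _ → refl)

  Λ-+ : ∀ n (F G : ℕ → ℕ → ℚ) → Λ (λ i j → F i j + G i j) n ≡ Λ F n + Λ G n
  Λ-+ n F G = ∑-+ (suc n) (λ i → F i (n ∸ i)) (λ i → G i (n ∸ i))

  Λ-*ˡ : ∀ n c (F : ℕ → ℕ → ℚ) → c * Λ F n ≡ Λ (λ i j → c * F i j) n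
  Λ-*ˡ n c F = ∑-*ˡ (suc n) c (λ i → F i (n ∸ i))

  Λ-last : ∀ n (F : ℕ → ℕ → ℚ) → Λ F (suc n) ≡ Λ (λ i j → F i (suc j)) n + F (suc n) 0
  Λ-last zero    F = trans (cong (F 0 1 +_) (+-identityʳ (F 1 0)))
                           (cong (_+ F 1 0) (sym (+-identityʳ (F 0 1))))
  Λ-last (suc n) F = trans (cong (F 0 (suc (suc n)) +_) (Λ-last n (F ∘ suc)))
                           (sym (+-assoc (F 0 (suc (suc n))) _ _))

  Λ-flip : ∀ n (F : ℕ → ℕ → ℚ) → Λ F n ≡ Λ (flip F) n
  Λ-flip zero    F = refl
  Λ-flip (suc n) F = begin
    F 0 (suc n) + Λ (F ∘ suc) n         ≡⟨ cong (F 0 (suc n) +_) (Λ-flip n (F ∘ suc)) ⟩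
    F 0 (suc n) + Λ (flip (F ∘ suc)) n  ≡⟨ +-comm (F 0 (suc n)) _ ⟩
    Λ (flip (F ∘ suc)) n + F 0 (suc n)  ≡⟨ Λ-last n (flip F) ⟨
    Λ (flip F) (suc n)                  ∎
    where open ≡-Reasoning

  -- Both sides sum `G` over the triples with sum `n`. The induction splits off the triples whose
  -- first entry is 0.
  Λ-assoc : ∀ n (G : ℕ → ℕ → ℕ → ℚ) →
            Λ (λ i k → Λ (λ a b → G a b k) i) n ≡ Λ (λ a m → Λ (G a) m) n
  Λ-assoc zero    G = refl
  Λ-assoc (suc n) G = begin
    (G 0 0 (suc n) + 0ℚ) + Λ (λ i k → G 0 (suc i) k + Λ (λ a b → G (suc a) b k) i) n
      ≡⟨ cong₂ _+_ (+-identityʳ (G 0 0 (suc n))) (Λ-+ n (λ i k → G 0 (suc i) k) (λ i k → Λ (λ a b → G (suc a) b k) i)) ⟩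
    G 0 0 (suc n) + (Λ (λ i k → G 0 (suc i) k) n + Λ (λ i k → Λ (λ a b → G (suc a) b k) i) n)
      ≡⟨ cong (λ s → G 0 0 (suc n) + (Λ (λ i k → G 0 (suc i) k) n + s)) (Λ-assoc n (G ∘ suc)) ⟩
    G 0 0 (suc n) + (Λ (λ i k → G 0 (suc i) k) n + Λ (λ a m → Λ (G (suc a)) m) n)
      ≡⟨ +-assoc (G 0 0 (suc n)) _ _ ⟨
    Λ (λ a m → Λ (G a) m) (suc n)  ∎
    where open ≡-Reasoning

infix  4 _≈_
infixl 7 _⊗_
infixl 6 _⊕_

_≈_ : (ℕ → ℚ) → (ℕ → ℚ) → Set
f ≈ g = ∀ n → f n ≡ g n

_⊕_ : (ℕ → ℚ) → (ℕ → ℚ) → ℕ → ℚ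
(f ⊕ g) n = f n + g n

_⊗_ : (ℕ → ℚ) → (ℕ → ℚ) → ℕ → ℚ
f ⊗ g = Λ (λ i j → f i * g j)

κ : ℚ → ℕ → ℚ
κ c zero    = c
κ c (suc n) = 0ℚ

⊗-cong : ∀ {f f′ g g′} → f ≈ f′ → g ≈ g′ → f ⊗ g ≈ f′ ⊗ g′
⊗-cong p q n = Λ-cong n λ i j _ → cong₂ _*_ (p i) (q j)

⊗-comm : ∀ f g → f ⊗ g ≈ g ⊗ f
⊗-comm f g n = trans (Λ-flip n _) (Λ-cong n λ i j _ → *-comm (f j) (g i))

⊗-assoc : ∀ f g h → (f ⊗ g) ⊗ h ≈ f ⊗ (g ⊗ h)
⊗-assoc f g h n = begin
  Λ (λ i k → Λ (λ a b → f a * g b) i * h k) n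
    ≡⟨ Λ-cong n (λ i k _ → trans (*-comm _ (h k)) (Λ-*ˡ i (h k) _)) ⟩
  Λ (λ i k → Λ (λ a b → h k * (f a * g b)) i) n
    ≡⟨ Λ-assoc n (λ a b k → h k * (f a * g b)) ⟩
  Λ (λ a m → Λ (λ b k → h k * (f a * g b)) m) n
    ≡⟨ Λ-cong n (λ a m _ → trans (Λ-cong m λ b k _ → rearrange (f a) (g b) (h k)) (sym (Λ-*ˡ m (f a) _))) ⟩
  Λ (λ a m → f a * Λ (λ b k → g b * h k) m) n  ∎
  where
  open ≡-Reasoning
  open Rat
  rearrange : ∀ x y z → z * (x * y) ≡ x * (y * z)
  rearrange = solve 3 (λ x y z → z :* (x :* y) := x :* (y :* z)) refl

κ-⊗ : ∀ c f n → (κ c ⊗ f) n ≡ c * f n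
κ-⊗ c f zero    = Λ-0 _
κ-⊗ c f (suc n) = begin
  (κ c ⊗ f) (suc n)                              ≡⟨ Λ-suc n _ ⟩
  c * f (suc n) + Λ (λ i j → 0ℚ * f j) n         ≡⟨ cong (c * f (suc n) +_) (Λ-zero n λ _ j _ → *-zeroˡ (f j)) ⟩
  c * f (suc n) + 0ℚ                             ≡⟨ +-identityʳ (c * f (suc n)) ⟩
  c * f (suc n)                                  ∎
  where open ≡-Reasoning

⊗-distribˡ : ∀ f g h → f ⊗ (g ⊕ h) ≈ f ⊗ g ⊕ f ⊗ h
⊗-distribˡ f g h n = trans (Λ-cong n λ i j _ → *-distribˡ-+ (f i) (g j) (h j)) (Λ-+ n _ _)

-- The ring of power series with rational coefficients

ℚ⟦q⟧ : CommutativeRing 0ℓ 0ℓ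
ℚ⟦q⟧ = record
  { Carrier = ℕ → ℚ
  ; _≈_ = _≈_
  ; _+_ = _⊕_
  ; _*_ = _⊗_
  ; -_  = λ f n → - f n
  ; 0#  = λ _ → 0ℚ
  ; 1#  = κ 1ℚ
  ; isCommutativeRing = record
    { isRing = record
      { +-isAbelianGroup = record
        { isGroup = record
          { isMonoid = record
            { isSemigroup = record
              { isMagma = record
                { isEquivalence = record
                  { refl  = λ _ → refl
                  ; sym   = λ p n → sym (p n)
                  ; trans = λ p q n → trans (p n) (q n)
                  }
                ; ∙-cong = λ p q n → cong₂ _+_ (p n) (q n)
                }
              ; assoc = λ f g h n → +-assoc (f n) (g n) (h n)
              }
            ; identity = (λ f n → +-identityˡ (f n)) , (λ f n → +-identityʳ (f n))
            }
          ; inverse = (λ f n → ℚ.+-inverseˡ (f n)) , (λ f n → ℚ.+-inverseʳ (f n))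
          ; ⁻¹-cong = λ p n → cong -_ (p n)
          }
        ; comm = λ f g n → +-comm (f n) (g n)
        }
      ; *-cong = ⊗-cong
      ; *-assoc = ⊗-assoc
      ; *-identity = ⊗-identityˡ , (λ f n → trans (⊗-comm f (κ 1ℚ) n) (⊗-identityˡ f n))
      ; distrib = ⊗-distribˡ , ⊗-distribʳ
      }
    ; *-comm = ⊗-comm
    }
  }
  where
  ⊗-identityˡ : ∀ f → κ 1ℚ ⊗ f ≈ f
  ⊗-identityˡ f n = trans (κ-⊗ 1ℚ f n) (*-identityˡ (f n))
  ⊗-distribʳ : ∀ f g h → (g ⊕ h) ⊗ f ≈ g ⊗ f ⊕ h ⊗ f
  ⊗-distribʳ f g h n = trans (⊗-comm (g ⊕ h) f n)
    (trans (⊗-distribˡ f g h n) (cong₂ _+_ (⊗-comm f g n) (⊗-comm f h n)))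

module A = CommutativeRing ℚ⟦q⟧

κ-0 : A.0# ≈ κ 0ℚ
κ-0 zero    = refl
κ-0 (suc n) = refl

-- Through this homomorphism the ring solver over power series computes with rational constants,
-- which its normal forms collect and compare.
κ-hom : CommutativeRing.rawRing ℚ.+-*-commutativeRing -Raw-AlmostCommutative⟶ fromCommutativeRing ℚ⟦q⟧
κ-hom = record
  { ⟦_⟧    = κ
  ; +-homo = λ { a b zero → refl ; a b (suc n) → refl }
  ; *-homo = λ { a b n → sym (trans (κ-⊗ a (κ b) n) (κ-scale a b n)) }
  ; -‿homo = λ { a zero → refl ; a (suc n) → refl }
  ; 0-homo = A.sym κ-0
  ; 1-homo = λ _ → refl
  }
  where
  κ-scale : ∀ a b n → a * κ b n ≡ κ (a * b) n
  κ-scale a b zero    = refl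
  κ-scale a b (suc n) = *-zeroʳ a

module Ser = Polynomials ℚ⟦q⟧ κ-hom

-- The embedding of the integers into the rationals

fromℤ-+ : ∀ a b → fromℤ (a ℤ.+ b) ≡ fromℤ a + fromℤ b
fromℤ-+ a b = ℚ.toℚᵘ-injective (ℚᵘ.≃-trans (ℚᵘ.*≡* (eq a b)) (ℚᵘ.≃-sym (ℚ.toℚᵘ-homo-+ (fromℤ a) (fromℤ b))))
  where
  open ℤ.+-*-Solver
  eq : ∀ a b → (a ℤ.+ b) ℤ.* 1ℤ ≡ (a ℤ.* 1ℤ ℤ.+ b ℤ.* 1ℤ) ℤ.* 1ℤ
  eq = solve 2 (λ a b → (a :+ b) :* con 1ℤ := (a :* con 1ℤ :+ b :* con 1ℤ) :* con 1ℤ) refl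

fromℤ-* : ∀ a b → fromℤ (a ℤ.* b) ≡ fromℤ a * fromℤ b
fromℤ-* a b = ℚ.toℚᵘ-injective (ℚᵘ.≃-trans (ℚᵘ.*≡* refl) (ℚᵘ.≃-sym (ℚ.toℚᵘ-homo-* (fromℤ a) (fromℤ b))))

fromℤ-neg : ∀ a → fromℤ (ℤ.- a) ≡ - fromℤ a
fromℤ-neg a = ℚ.toℚᵘ-injective (ℚᵘ.≃-trans (ℚᵘ.*≡* refl) (ℚᵘ.≃-sym (ℚ.toℚᵘ-homo‿- (fromℤ a))))

↑-+ : ∀ m n → ↑ (m ℕ.+ n) ≡ ↑ m + ↑ n
↑-+ m n = fromℤ-+ (ℤ.+ m) (ℤ.+ n)

↑-* : ∀ m n → ↑ (m ℕ.* n) ≡ ↑ m * ↑ n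
↑-* m n = trans (cong fromℤ (ℤ.pos-* m n)) (fromℤ-* (ℤ.+ m) (ℤ.+ n))

↑-^ : ∀ m k → ↑ (m ℕ.^ k) ≡ ↑ m ^ℚ k
↑-^ m zero    = refl
↑-^ m (suc k) = trans (↑-* m (m ℕ.^ k)) (cong (↑ m *_) (↑-^ m k))

-- The derivation D = q d/dq

D : (ℕ → ℚ) → ℕ → ℚ
D f n = ↑ n * f n

D-cong : ∀ {f g} → f ≈ g → D f ≈ D g
D-cong p n = cong (↑ n *_) (p n)

D-⊕ : ∀ f g → D (f ⊕ g) ≈ D f ⊕ D g
D-⊕ f g n = *-distribˡ-+ (↑ n) (f n) (g n)

D-neg : ∀ f → D (A.- f) ≈ A.- D f
D-neg f n = sym (ℚ.neg-distribʳ-* (↑ n) (f n))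

D-κ : ∀ c → D (κ c) ≈ A.0#
D-κ c zero    = *-zeroˡ c
D-κ c (suc n) = *-zeroʳ (↑ suc n)

D-⊗ : ∀ f g → D (f ⊗ g) ≈ D f ⊗ g ⊕ f ⊗ D g
D-⊗ f g n = begin
  ↑ n * Λ (λ i j → f i * g j) n                                 ≡⟨ Λ-*ˡ n (↑ n) _ ⟩
  Λ (λ i j → ↑ n * (f i * g j)) n                               ≡⟨ Λ-cong n leibniz ⟩
  Λ (λ i j → ↑ i * f i * g j + f i * (↑ j * g j)) n             ≡⟨ Λ-+ n _ _ ⟩
  (D f ⊗ g ⊕ f ⊗ D g) n                                         ∎
  where
  open ≡-Reasoning
  open Rat
  distribute : ∀ i j x y → (i + j) * (x * y) ≡ i * x * y + x * (j * y)
  distribute = solve 4 (λ i j x y → (i :+ j) :* (x :* y) := i :* x :* y :+ x :* (j :* y)) refl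
  leibniz : ∀ i j → i ℕ.+ j ≡ n → ↑ n * (f i * g j) ≡ ↑ i * f i * g j + f i * (↑ j * g j)
  leibniz i j refl = trans (cong (_* (f i * g j)) (↑-+ i j)) (distribute (↑ i) (↑ j) (f i) (g j))

-- Monomials and logarithmic derivatives

mono : ℕ → ℕ → ℚ
mono k = fromℤ ∘ (q^ k)

mono-0 : mono 0 ≈ κ 1ℚ
mono-0 zero    = refl
mono-0 (suc n) = refl

mono-suc-⊗-0 : ∀ k f → (mono (suc k) ⊗ f) 0 ≡ 0ℚ
mono-suc-⊗-0 k f = trans (Λ-0 _) (*-zeroˡ (f 0))

mono-suc-⊗-suc : ∀ k f n → (mono (suc k) ⊗ f) (suc n) ≡ (mono k ⊗ f) n
mono-suc-⊗-suc k f n = trans (Λ-suc n _) (trans (cong (_+ (mono k ⊗ f) n) (*-zeroˡ (f (suc n)))) (+-identityˡ _))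

mono-⊗ : ∀ k f n → (mono k ⊗ f) (k ℕ.+ n) ≡ f n
mono-⊗ zero    f n = trans (A.*-congʳ {f} {mono 0} {κ 1ℚ} mono-0 n) (A.*-identityˡ f n)
mono-⊗ (suc k) f n = trans (mono-suc-⊗-suc k f (k ℕ.+ n)) (mono-⊗ k f n)

mono-⊗-low : ∀ k f n → n < k → (mono k ⊗ f) n ≡ 0ℚ
mono-⊗-low (suc k) f zero    _         = mono-suc-⊗-0 k f
mono-⊗-low (suc k) f (suc n) (s≤s n<k) = trans (mono-suc-⊗-suc k f n) (mono-⊗-low k f n n<k)

mono-+ : ∀ j k → mono j ⊗ mono k ≈ mono (j ℕ.+ k)
mono-+ zero    k n       = trans (A.*-congʳ {mono k} {mono 0} {κ 1ℚ} mono-0 n) (A.*-identityˡ (mono k) n)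
mono-+ (suc j) k zero    = mono-suc-⊗-0 j (mono k)
mono-+ (suc j) k (suc n) = trans (mono-suc-⊗-suc j (mono k) n) (mono-+ j k n)

D-mono : ∀ k → D (mono k) ≈ κ (↑ k) ⊗ mono k
D-mono k n = trans (weight k n) (sym (κ-⊗ (↑ k) (mono k) n))
  where
  weight : ∀ k n → ↑ n * mono k n ≡ ↑ k * mono k n
  weight k n with n ≡ᵇ k in eq
  ... | true  = cong (λ m → ↑ m * 1ℚ) (ℕ.≡ᵇ⇒≡ n k (subst T (sym eq) _))
  ... | false = trans (*-zeroʳ (↑ n)) (sym (*-zeroʳ (↑ k)))

-- A record, so that f and g can be inferred from its type
record LogDerivative (f g : ℕ → ℚ) : Set where
  constructor mk
  field D-log : D f ≈ g ⊗ f
open LogDerivative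

log-cong : ∀ {f f′ g g′} → f ≈ f′ → g ≈ g′ → LogDerivative f g → LogDerivative f′ g′
log-cong {f} {f′} {g} p q log = mk (A.trans (D-cong (A.sym p)) (A.trans (D-log log) (A.*-cong {g} q p)))

log-one : LogDerivative (κ 1ℚ) A.0#
log-one = mk (A.trans (D-κ 1ℚ) (A.sym (A.zeroˡ (κ 1ℚ))))

log-⊗ : ∀ {f f′ g g′} → LogDerivative f g → LogDerivative f′ g′ → LogDerivative (f ⊗ f′) (g ⊕ g′)
log-⊗ {f} {f′} {g} {g′} p q = mk (begin
  D (f ⊗ f′)                       ≈⟨ D-⊗ f f′ ⟩
  D f ⊗ f′ ⊕ f ⊗ D f′              ≈⟨ A.+-cong (A.*-congʳ {f′} (D-log p)) (A.*-congˡ {f} (D-log q)) ⟩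
  (g ⊗ f) ⊗ f′ ⊕ f ⊗ (g′ ⊗ f′)     ≈⟨ collect f f′ g g′ ⟩
  (g ⊕ g′) ⊗ (f ⊗ f′)              ∎)
  where
  open import Relation.Binary.Reasoning.Setoid A.setoid
  open Ser
  collect : ∀ f f′ g g′ → (g ⊗ f) ⊗ f′ ⊕ f ⊗ (g′ ⊗ f′) ≈ (g ⊕ g′) ⊗ (f ⊗ f′)
  collect = solve 4 (λ f f′ g g′ → (g :* f) :* f′ :+ f :* (g′ :* f′) := (g :+ g′) :* (f :* f′)) A.refl

-- Differentiating f′ f = 1 gives D f′ f + f′ g f = 0. Since f′ is a unit, D f′ = -g f′ follows
-- after multiplying by f′ and using f′ f = 1 again.
log-inverse : ∀ {f f′ g} → LogDerivative f g → f′ ⊗ f ≈ κ 1ℚ → LogDerivative f′ (A.- g)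
log-inverse {f} {f′} {g} p inverse = mk (begin
  D f′                                ≈⟨ A.*-identityʳ (D f′) ⟨
  D f′ ⊗ κ 1ℚ                         ≈⟨ A.*-congˡ {D f′} inverse ⟨
  D f′ ⊗ (f′ ⊗ f)                     ≈⟨ expand f f′ g (D f′) ⟩
  f′ ⊗ (D f′ ⊗ f ⊕ f′ ⊗ (g ⊗ f) A.- g ⊗ (f′ ⊗ f))
    ≈⟨ A.*-congˡ {f′} (A.+-cong product (A.-‿cong (A.*-congˡ {g} inverse))) ⟩
  f′ ⊗ (κ 0ℚ A.- g ⊗ κ 1ℚ)            ≈⟨ simplify f′ g ⟩
  A.- g ⊗ f′                          ∎)
  where
  open import Relation.Binary.Reasoning.Setoid A.setoid
  open Ser
  product : D f′ ⊗ f ⊕ f′ ⊗ (g ⊗ f) ≈ κ 0ℚ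
  product = begin
    D f′ ⊗ f ⊕ f′ ⊗ (g ⊗ f)   ≈⟨ A.+-congˡ {D f′ ⊗ f} (A.*-congˡ {f′} (D-log p)) ⟨
    D f′ ⊗ f ⊕ f′ ⊗ D f       ≈⟨ D-⊗ f′ f ⟨
    D (f′ ⊗ f)                ≈⟨ D-cong inverse ⟩
    D (κ 1ℚ)                  ≈⟨ A.trans (D-κ 1ℚ) κ-0 ⟩
    κ 0ℚ                      ∎
  expand : ∀ f f′ g d → d ⊗ (f′ ⊗ f) ≈ f′ ⊗ (d ⊗ f ⊕ f′ ⊗ (g ⊗ f) A.- g ⊗ (f′ ⊗ f))
  expand = solve 4 (λ f f′ g d → d :* (f′ :* f) := f′ :* (d :* f :+ f′ :* (g :* f) :- g :* (f′ :* f))) A.refl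
  simplify : ∀ f g → f ⊗ (κ 0ℚ A.- g ⊗ κ 1ℚ) ≈ A.- g ⊗ f
  simplify = solve 2 (λ f g → f :* (con 0ℚ :- g :* con 1ℚ) := :- g :* f) A.refl

-- The Lambert series u_x

v : ℕ → ℕ → ℚ
v x n = if does (x ∣? n) then 1ℚ else 0ℚ

-- For x ≥ 1 the series `v x` is the geometric series 1 / (1 - q^x), constant term included; without
-- that term it is q^x / (1 - q^x).
u : ℕ → ℕ → ℚ
u x = v x A.- κ 1ℚ

v-0 : ∀ x → v x 0 ≡ 1ℚ
v-0 x with x ∣? 0
... | yes _   = refl
... | no  x∤0 = ⊥-elim (x∤0 (x ∣0))

v-low : ∀ {x n} → suc n < x → v x (suc n) ≡ 0ℚ
v-low {x} {n} n<x with x ∣? suc n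
... | yes x∣n = ⊥-elim (>⇒∤ n<x x∣n)
... | no  _   = refl

v-periodic : ∀ x n → v x (x ℕ.+ n) ≡ v x n
v-periodic x n with x ∣? x ℕ.+ n | x ∣? n
... | yes _ | yes _ = refl
... | no _  | no _  = refl
... | yes p | no ¬q = ⊥-elim (¬q (∣m+n∣m⇒∣n p ∣-refl))
... | no ¬p | yes q = ⊥-elim (¬p (∣m∣n⇒∣m+n ∣-refl q))

-- Multiplication by 1 - q^x subtracts the coefficient x places earlier. Divisibility by x has
-- period x, so everything cancels except the coefficients below x, of which only the constant one
-- is nonzero.
v-geometric : ∀ x → v (suc x) ⊗ (κ 1ℚ A.- mono (suc x)) ≈ κ 1ℚ
v-geometric x n = trans (expand (v y) (mono y) n) (difference n)
  where
  open Ser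
  y = suc x
  expand : ∀ f a → f ⊗ (κ 1ℚ A.- a) ≈ f A.- a ⊗ f
  expand = solve 2 (λ f a → f :* (con 1ℚ :- a) := f :- a :* f) A.refl
  low : ∀ n → n < y → v y n ≡ κ 1ℚ n
  low zero    _   = v-0 y
  low (suc n) n<y = v-low n<y
  difference : ∀ n → v y n - (mono y ⊗ v y) n ≡ κ 1ℚ n
  difference n with n ℕ.<? y
  ... | yes n<y = trans (cong₂ _-_ (low n n<y) (mono-⊗-low y (v y) n n<y)) (+-identityʳ (κ 1ℚ n))
  ... | no  n≮y = subst (λ n → v y n - (mono y ⊗ v y) n ≡ κ 1ℚ n) (ℕ.m+[n∸m]≡n (ℕ.≮⇒≥ n≮y))
    (trans (cong₂ _-_ (v-periodic y (n ∸ y)) (mono-⊗ y (v y) (n ∸ y))) (ℚ.+-inverseʳ (v y (n ∸ y))))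

-- 1 - ab = (1 - a) + (1 - b) - (1 - a)(1 - b)
geometric-product : ∀ a b f g h → f ⊗ (κ 1ℚ A.- a) ≈ κ 1ℚ → g ⊗ (κ 1ℚ A.- b) ≈ κ 1ℚ →
  h ⊗ (κ 1ℚ A.- a ⊗ b) ≈ κ 1ℚ → f ⊗ g ≈ h ⊗ (f ⊕ g A.- κ 1ℚ)
geometric-product a b f g h p q r = begin
  f ⊗ g
    ≈⟨ A.*-identityʳ (f ⊗ g) ⟨
  f ⊗ g ⊗ κ 1ℚ
    ≈⟨ A.*-congˡ {f ⊗ g} r ⟨
  f ⊗ g ⊗ (h ⊗ (κ 1ℚ A.- a ⊗ b))
    ≈⟨ rearrange a b f g h ⟩
  h ⊗ (f ⊗ (g ⊗ (κ 1ℚ A.- b)) ⊕ g ⊗ (f ⊗ (κ 1ℚ A.- a)) A.- (f ⊗ (κ 1ℚ A.- a)) ⊗ (g ⊗ (κ 1ℚ A.- b)))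
    ≈⟨ A.*-congˡ {h} (A.+-cong (A.+-cong (A.*-congˡ {f} q) (A.*-congˡ {g} p)) (A.-‿cong (A.*-cong p q))) ⟩
  h ⊗ (f ⊗ κ 1ℚ ⊕ g ⊗ κ 1ℚ A.- κ 1ℚ ⊗ κ 1ℚ)
    ≈⟨ simplify f g h ⟩
  h ⊗ (f ⊕ g A.- κ 1ℚ)  ∎
  where
  open import Relation.Binary.Reasoning.Setoid A.setoid
  open Ser
  rearrange : ∀ a b f g h → f ⊗ g ⊗ (h ⊗ (κ 1ℚ A.- a ⊗ b)) ≈
    h ⊗ (f ⊗ (g ⊗ (κ 1ℚ A.- b)) ⊕ g ⊗ (f ⊗ (κ 1ℚ A.- a)) A.- (f ⊗ (κ 1ℚ A.- a)) ⊗ (g ⊗ (κ 1ℚ A.- b)))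
  rearrange = solve 5 (λ a b f g h → f :* g :* (h :* (con 1ℚ :- a :* b)) :=
    h :* (f :* (g :* (con 1ℚ :- b)) :+ g :* (f :* (con 1ℚ :- a)) :- (f :* (con 1ℚ :- a)) :* (g :* (con 1ℚ :- b)))) A.refl
  simplify : ∀ f g h → h ⊗ (f ⊗ κ 1ℚ ⊕ g ⊗ κ 1ℚ A.- κ 1ℚ ⊗ κ 1ℚ) ≈ h ⊗ (f ⊕ g A.- κ 1ℚ)
  simplify = solve 3 (λ f g h → h :* (f :* con 1ℚ :+ g :* con 1ℚ :- con 1ℚ :* con 1ℚ) := h :* (f :+ g :- con 1ℚ)) A.refl

-- With z = x + y, `geometric-product` gives v_x v_y = v_z (v_x + v_y - 1), while u_x u_y = v_x v_y
-- - (v_x + v_y - 1). Together u_x u_y = u_z (v_x + v_y - 1), and v_x + v_y - 1 = u_x + u_y + 1.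
u-product : ∀ i j → let x = suc i; y = suc j in
  u x ⊗ u y ≈ (u x ⊗ u (x ℕ.+ y) ⊕ u (x ℕ.+ y) ⊗ u y) ⊕ u (x ℕ.+ y)
u-product i j = begin
  u x ⊗ u y                              ≈⟨ expand (v x) (v y) ⟩
  v x ⊗ v y A.- (v x ⊕ v y A.- κ 1ℚ)     ≈⟨ A.+-congʳ product ⟩
  v z ⊗ (v x ⊕ v y A.- κ 1ℚ) A.- (v x ⊕ v y A.- κ 1ℚ)
                                         ≈⟨ collect (v x) (v y) (v z) ⟩
  u x ⊗ u z ⊕ u z ⊗ u y ⊕ u z            ∎
  where
  open import Relation.Binary.Reasoning.Setoid A.setoid
  open Ser
  x = suc i
  y = suc j
  z = x ℕ.+ y
  product : v x ⊗ v y ≈ v z ⊗ (v x ⊕ v y A.- κ 1ℚ)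
  product = geometric-product (mono x) (mono y) (v x) (v y) (v z) (v-geometric i) (v-geometric j)
    (A.trans (A.*-congˡ {v z} (A.+-congˡ {κ 1ℚ} (A.-‿cong (mono-+ x y)))) (v-geometric (i ℕ.+ y)))
  expand : ∀ f g → (f A.- κ 1ℚ) ⊗ (g A.- κ 1ℚ) ≈ f ⊗ g A.- (f ⊕ g A.- κ 1ℚ)
  expand = solve 2 (λ f g → (f :- con 1ℚ) :* (g :- con 1ℚ) := f :* g :- (f :+ g :- con 1ℚ)) A.refl
  collect : ∀ f g h → h ⊗ (f ⊕ g A.- κ 1ℚ) A.- (f ⊕ g A.- κ 1ℚ) ≈
    (f A.- κ 1ℚ) ⊗ (h A.- κ 1ℚ) ⊕ (h A.- κ 1ℚ) ⊗ (g A.- κ 1ℚ) ⊕ (h A.- κ 1ℚ)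
  collect = solve 3 (λ f g h → h :* (f :+ g :- con 1ℚ) :- (f :+ g :- con 1ℚ) :=
    (f :- con 1ℚ) :* (h :- con 1ℚ) :+ (h :- con 1ℚ) :* (g :- con 1ℚ) :+ (h :- con 1ℚ)) A.refl

u-low : ∀ {x n} → n < x → u x n ≡ 0ℚ
u-low {x} {zero}  _   = cong (_- 1ℚ) (v-0 x)
u-low {x} {suc n} n<x = trans (+-identityʳ (v x (suc n))) (v-low n<x)

-- The product starts at q^(x + y). So a sum over a square of pairs (x , y) may be cut down to the
-- triangle x + y ≤ n, where it can be regrouped by z = x + y.
u-⊗-low : ∀ {x y n} → n < x ℕ.+ y → (u x ⊗ u y) n ≡ 0ℚ
u-⊗-low {x} {y} {n} n<x+y = Λ-zero n vanish
  where
  vanish : ∀ i j → i ℕ.+ j ≡ n → u x i * u y j ≡ 0ℚ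
  vanish i j refl with i ℕ.<? x | j ℕ.<? y
  ... | yes i<x | _       = trans (cong (_* u y j) (u-low i<x)) (*-zeroˡ (u y j))
  ... | no _    | yes j<y = trans (cong (u x i *_) (u-low j<y)) (*-zeroʳ (u x i))
  ... | no i≮x  | no j≮y  = ⊥-elim (ℕ.<⇒≱ n<x+y (ℕ.+-mono-≤ (ℕ.≮⇒≥ i≮x) (ℕ.≮⇒≥ j≮y)))

-- D (1 - q^x) = -x q^x and q^x = u_x (1 - q^x). This serves twice: inverted, for the derivative of
-- u_x, and directly, for the factors of the product defining τ.
log-1-mono : ∀ i → LogDerivative (κ 1ℚ A.- mono (suc i)) (A.- (κ (↑ suc i) ⊗ u (suc i)))
log-1-mono i = mk (begin
  D (κ 1ℚ A.- a)                     ≈⟨ D-⊕ (κ 1ℚ) (A.- a) ⟩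
  D (κ 1ℚ) ⊕ D (A.- a)               ≈⟨ A.+-cong (D-κ 1ℚ) (A.trans (D-neg a) (A.-‿cong (D-mono x))) ⟩
  A.0# A.- c ⊗ a                     ≈⟨ A.+-identityˡ (A.- (c ⊗ a)) ⟩
  A.- (c ⊗ a)                        ≈⟨ A.-‿cong (A.*-congˡ {c} numerator) ⟩
  A.- (c ⊗ (u x ⊗ (κ 1ℚ A.- a)))     ≈⟨ rearrange c (u x) (κ 1ℚ A.- a) ⟩
  A.- (c ⊗ u x) ⊗ (κ 1ℚ A.- a)       ∎)
  where
  open import Relation.Binary.Reasoning.Setoid A.setoid
  open Ser
  x = suc i
  a = mono x
  c = κ (↑ x)
  rearrange : ∀ c f g → A.- (c ⊗ (f ⊗ g)) ≈ A.- (c ⊗ f) ⊗ g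
  rearrange = solve 3 (λ c f g → :- (c :* (f :* g)) := :- (c :* f) :* g) A.refl
  split : ∀ a f → (f A.- κ 1ℚ) ⊗ (κ 1ℚ A.- a) ≈ f ⊗ (κ 1ℚ A.- a) A.- κ 1ℚ ⊕ a
  split = solve 2 (λ a f → (f :- con 1ℚ) :* (con 1ℚ :- a) := f :* (con 1ℚ :- a) :- con 1ℚ :+ a) A.refl
  cancel : ∀ a → κ 1ℚ A.- κ 1ℚ ⊕ a ≈ a
  cancel = solve 1 (λ a → con 1ℚ :- con 1ℚ :+ a := a) A.refl
  numerator : a ≈ u x ⊗ (κ 1ℚ A.- a)
  numerator = A.sym (A.trans (split a (v x)) (A.trans (A.+-congʳ {a} (A.+-congʳ (v-geometric i))) (cancel a)))

-- As the inverse of 1 - q^x, the series v_x has logarithmic derivative x u_x. Hence D u_x = D v_x =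
-- x u_x v_x = x u_x (u_x + 1).
u-square : ∀ i → let x = suc i in κ (↑ x) ⊗ (u x ⊗ u x) ≈ D (u x) A.- κ (↑ x) ⊗ u x
u-square i = begin
  c ⊗ (u x ⊗ u x)                       ≈⟨ expand c (v x) ⟩
  A.- (A.- (c ⊗ u x)) ⊗ v x A.- c ⊗ u x ≈⟨ A.+-congʳ (D-log (log-inverse (log-1-mono i) (v-geometric i))) ⟨
  D (v x) A.- c ⊗ u x                   ≈⟨ A.+-congʳ constant ⟨
  D (u x) A.- c ⊗ u x                   ∎
  where
  open import Relation.Binary.Reasoning.Setoid A.setoid
  open Ser
  x = suc i
  c = κ (↑ x)
  expand : ∀ c f → c ⊗ ((f A.- κ 1ℚ) ⊗ (f A.- κ 1ℚ)) ≈ A.- (A.- (c ⊗ (f A.- κ 1ℚ))) ⊗ f A.- c ⊗ (f A.- κ 1ℚ)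
  expand = solve 2 (λ c f → c :* ((f :- con 1ℚ) :* (f :- con 1ℚ)) := :- (:- (c :* (f :- con 1ℚ))) :* f :- c :* (f :- con 1ℚ)) A.refl
  constant : D (v x A.- κ 1ℚ) ≈ D (v x)
  constant n = trans (D-⊕ (v x) (A.- κ 1ℚ) n) (trans
    (cong (D (v x) n +_) (trans (D-neg (κ 1ℚ) n) (cong -_ (D-κ 1ℚ n)))) (+-identityʳ (D (v x) n)))

-- Divisor sums as Lambert series

S : ℕ → ℕ → ℚ
S k n = ↑ (σ k n)

opaque
  unfolding ∑
  ↑-sum-filter : ∀ {P : ℕ → Set} (P? : ∀ x → Dec (P x)) (g f : ℕ → ℕ) m →
    ↑ (sum (List.map g (filter P? (applyUpTo f m)))) ≡ ∑ m (λ i → if does (P? (f i)) then ↑ g (f i) else 0ℚ)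
  ↑-sum-filter P? g f zero    = refl
  ↑-sum-filter P? g f (suc m) with does (P? (f 0))
  ... | true  = trans (↑-+ (g (f 0)) _) (cong ((↑ g (f 0)) +_) (↑-sum-filter P? g (f ∘ suc) m))
  ... | false = trans (↑-sum-filter P? g (f ∘ suc) m) (sym (+-identityˡ _))

-- The bound `N` is free because the two factors of a product are read at different coefficients but
-- have to be expanded over a common range.
S-∑ : ∀ k {n N} → n ≤ N → S k n ≡ ∑ N (λ i → ↑ suc i ^ℚ k * u (suc i) n)
S-∑ k {n} {N} n≤N = begin
  S k n
    ≡⟨ cong (λ xs → ↑ (sum (List.map (ℕ._^ k) (filter (_∣? n) xs)))) (List.map-upTo suc n) ⟩
  ↑ (sum (List.map (ℕ._^ k) (filter (_∣? n) (applyUpTo suc n))))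
    ≡⟨ ↑-sum-filter (_∣? n) (ℕ._^ k) suc n ⟩
  ∑ n (λ i → if does (suc i ∣? n) then ↑ (suc i ℕ.^ k) else 0ℚ)
    ≡⟨ ∑-cong n (λ i i<n → term i n i<n) ⟩
  ∑ n (λ i → ↑ suc i ^ℚ k * u (suc i) n)
    ≡⟨ ∑-truncate _ n≤N (λ i n≤i → trans (cong ((↑ suc i ^ℚ k) *_) (u-low (s≤s n≤i))) (*-zeroʳ (↑ suc i ^ℚ k))) ⟨
  ∑ N (λ i → ↑ suc i ^ℚ k * u (suc i) n)  ∎
  where
  open ≡-Reasoning
  term : ∀ i n → i < n → (if does (suc i ∣? n) then ↑ (suc i ℕ.^ k) else 0ℚ) ≡ ↑ suc i ^ℚ k * u (suc i) n
  term i (suc n) _ with does (suc i ∣? suc n)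
  ... | true  = trans (↑-^ (suc i) k) (sym (*-identityʳ (↑ suc i ^ℚ k)))
  ... | false = sym (*-zeroʳ (↑ suc i ^ℚ k))

S-⊗-∑ : ∀ k l n → (S k ⊗ S l) n ≡
  ∑ n (λ i → ∑ n (λ j → (↑ suc i ^ℚ k * ↑ suc j ^ℚ l) * (u (suc i) ⊗ u (suc j)) n))
S-⊗-∑ k l n = begin
  Λ (λ a b → S k a * S l b) n
    ≡⟨ Λ-cong n (λ { a b refl → expand a b }) ⟩
  Λ (λ a b → ∑ n (λ i → ∑ n (λ j → (↑ suc i ^ℚ k * ↑ suc j ^ℚ l) * (u (suc i) a * u (suc j) b)))) n
    ≡⟨ trans (Λ-∑ n n _) (∑-cong n λ i _ → trans (Λ-∑ n n _) (∑-cong n λ j _ →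
         sym (Λ-*ˡ n (↑ suc i ^ℚ k * ↑ suc j ^ℚ l) _))) ⟩
  ∑ n (λ i → ∑ n (λ j → (↑ suc i ^ℚ k * ↑ suc j ^ℚ l) * (u (suc i) ⊗ u (suc j)) n))  ∎
  where
  open ≡-Reasoning
  open Rat
  rearrange : ∀ a b c d → (a * b) * (c * d) ≡ (a * c) * (b * d)
  rearrange = solve 4 (λ a b c d → (a :* b) :* (c :* d) := (a :* c) :* (b :* d)) refl
  expand : ∀ a b → S k a * S l b ≡ ∑ (a ℕ.+ b) (λ i → ∑ (a ℕ.+ b) (λ j →
    (↑ suc i ^ℚ k * ↑ suc j ^ℚ l) * (u (suc i) a * u (suc j) b)))
  expand a b = begin
    S k a * S l b
      ≡⟨ cong₂ _*_ (S-∑ k (ℕ.m≤m+n a b)) (S-∑ l (ℕ.m≤n+m b a)) ⟩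
    ∑ m (λ i → ↑ suc i ^ℚ k * u (suc i) a) * ∑ m (λ j → ↑ suc j ^ℚ l * u (suc j) b)
      ≡⟨ trans (*-comm (∑ m λ i → ↑ suc i ^ℚ k * u (suc i) a) (∑ m λ j → ↑ suc j ^ℚ l * u (suc j) b))
               (∑-*ˡ m (∑ m λ j → ↑ suc j ^ℚ l * u (suc j) b) _) ⟩
    ∑ m (λ i → ∑ m (λ j → ↑ suc j ^ℚ l * u (suc j) b) * (↑ suc i ^ℚ k * u (suc i) a))
      ≡⟨ ∑-cong m (λ i _ → trans (*-comm (∑ m λ j → ↑ suc j ^ℚ l * u (suc j) b) (↑ suc i ^ℚ k * u (suc i) a))
           (trans (∑-*ˡ m (↑ suc i ^ℚ k * u (suc i) a) _) (∑-cong m λ j _ →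
             rearrange (↑ suc i ^ℚ k) (u (suc i) a) (↑ suc j ^ℚ l) (u (suc j) b)))) ⟩
    ∑ m (λ i → ∑ m (λ j → (↑ suc i ^ℚ k * ↑ suc j ^ℚ l) * (u (suc i) a * u (suc j) b)))  ∎
    where m = a ℕ.+ b

-- Skoruppa's summation

opaque
  unfolding ∑ Λ

  -- With x = suc k, y = suc l and z = suc i this sums over the pairs with x + y = z.
  below : (ℕ → ℕ → ℚ) → ℕ → ℚ
  below F i = ∑ i (λ k → F k (i ∸ suc k))

  below-cong : ∀ i {F G : ℕ → ℕ → ℚ} → (∀ k l → suc (k ℕ.+ l) ≡ i → F k l ≡ G k l) → below F i ≡ below G i
  below-cong i eq = ∑-cong i λ k k<i → eq k (i ∸ suc k) (ℕ.m+[n∸m]≡n k<i)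

  below-+ : ∀ i (F G : ℕ → ℕ → ℚ) → below (λ k l → F k l + G k l) i ≡ below F i + below G i
  below-+ i F G = ∑-+ i (λ k → F k (i ∸ suc k)) (λ k → G k (i ∸ suc k))

  below-*ˡ : ∀ i c (F : ℕ → ℕ → ℚ) → c * below F i ≡ below (λ k l → c * F k l) i
  below-*ˡ i c F = ∑-*ˡ i c (λ k → F k (i ∸ suc k))

  below-flip : ∀ i F → below F i ≡ below (flip F) i
  below-flip zero    F = refl
  below-flip (suc i) F = Λ-flip i F

  below-∑ : ∀ i (f : ℕ → ℚ) → below (λ k _ → f k) i ≡ ∑ i f
  below-∑ i f = refl

  -- The antidiagonals gain one entry from each row. Rows and columns have separate bounds because
  -- removing the first row in the induction shortens only the range of rows.
  ∑-triangle : ∀ m n F → m ≤ n → (∀ i j → m ≤ suc (i ℕ.+ j) → F i j ≡ 0ℚ) →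
               ∑ m (λ i → ∑ n (F i)) ≡ ∑ m (below F)
  ∑-triangle zero    n F _   vanish = refl
  ∑-triangle (suc m) n F m<n vanish = begin
    ∑ n (F 0) + ∑ m (λ i → ∑ n (F (suc i)))
      ≡⟨ cong₂ _+_ (∑-truncate (F 0) (ℕ.<⇒≤ m<n) λ j m≤j → vanish 0 j (s≤s m≤j))
                   (∑-triangle m n (F ∘ suc) (ℕ.<⇒≤ m<n) λ i j m≤ → vanish (suc i) j (s≤s m≤)) ⟩
    ∑ m (F 0) + ∑ m (below (F ∘ suc))
      ≡⟨ ∑-+ m (F 0) (below (F ∘ suc)) ⟨
    ∑ m (λ i → F 0 i + below (F ∘ suc) i)
      ≡⟨ +-identityˡ _ ⟨
    ∑ (suc m) (below F)  ∎
    where open ≡-Reasoning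

∑-square : ∀ n (G : ℕ → ℕ → ℚ) →
           ∑ n (λ i → ∑ n (G i)) ≡ ∑ n (λ i → ∑ i (λ k → G k i) + ∑ i (G i) + G i i)
∑-square zero    G = trans (∑-0 _) (sym (∑-0 _))
∑-square (suc n) G = begin
  ∑ (suc n) (λ i → ∑ (suc n) (G i))
    ≡⟨ ∑-last n _ ⟩
  ∑ n (λ i → ∑ (suc n) (G i)) + ∑ (suc n) (G n)
    ≡⟨ cong₂ _+_ (trans (∑-cong n λ i _ → ∑-last n (G i)) (∑-+ n _ _)) (∑-last n (G n)) ⟩
  (∑ n (λ i → ∑ n (G i)) + ∑ n (λ k → G k n)) + (∑ n (G n) + G n n)
    ≡⟨ reassociate (∑ n λ i → ∑ n (G i)) (∑ n λ k → G k n) (∑ n (G n)) (G n n) ⟩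
  ∑ n (λ i → ∑ n (G i)) + (∑ n (λ k → G k n) + ∑ n (G n) + G n n)
    ≡⟨ cong (_+ (∑ n (λ k → G k n) + ∑ n (G n) + G n n)) (∑-square n G) ⟩
  ∑ n (λ i → ∑ i (λ k → G k i) + ∑ i (G i) + G i i) + (∑ n (λ k → G k n) + ∑ n (G n) + G n n)
    ≡⟨ ∑-last n _ ⟨
  ∑ (suc n) (λ i → ∑ i (λ k → G k i) + ∑ i (G i) + G i i)  ∎
  where
  open ≡-Reasoning
  open Rat
  reassociate : ∀ a b c d → (a + b) + (c + d) ≡ a + (b + c + d)
  reassociate = solve 4 (λ a b c d → (a :+ b) :+ (c :+ d) := a :+ (b :+ c :+ d)) refl

module _ (h : ℚ → ℚ → ℚ) (h-invariant : ∀ x y → h x (y - x) ≡ h (x - y) y) (n : ℕ) where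
  open Rat using (solve; _:=_; _:+_; _:*_; _:-_)

  private
    ↑⁺ : ℕ → ℚ
    ↑⁺ i = ↑ suc i

    C : ℕ → ℕ → ℚ
    C i j = (u (suc i) ⊗ u (suc j)) n

    E : ℕ → ℚ
    E i = u (suc i) n

    -- The difference y - x is negative for x > y and 0 on the diagonal; this is why kernels are
    -- functions on the rationals.
    G : ℕ → ℕ → ℚ
    G i j = h (↑⁺ i) (↑⁺ j - ↑⁺ i) * C i j

    ↑⁺-difference : ∀ k l → ↑⁺ l ≡ ↑⁺ (suc (k ℕ.+ l)) - ↑⁺ k
    ↑⁺-difference k l = begin
      ↑⁺ l                      ≡⟨ cancel (↑⁺ k) (↑⁺ l) ⟩
      (↑⁺ k + ↑⁺ l) - ↑⁺ k      ≡⟨ cong (_- ↑⁺ k) (↑-+ (suc k) (suc l)) ⟨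
      ↑ (suc k ℕ.+ suc l) - ↑⁺ k  ≡⟨ cong (λ m → ↑ m - ↑⁺ k) (cong suc (ℕ.+-suc k l)) ⟩
      ↑⁺ (suc (k ℕ.+ l)) - ↑⁺ k ∎
      where
      open ≡-Reasoning
      cancel : ∀ a b → b ≡ (a + b) - a
      cancel = solve 2 (λ a b → b := (a :+ b) :- a) refl

    split : ∀ k l → C k l ≡ (C k (suc (k ℕ.+ l)) + C (suc (k ℕ.+ l)) l) + E (suc (k ℕ.+ l))
    split k l = subst (λ z → C k l ≡ (u (suc k) ⊗ u z) n + (u z ⊗ u (suc l)) n + u z n)
      (cong suc (ℕ.+-suc k l)) (u-product k l n)

    -- Here i stands for z = x + y. The term u_x u_z has weight h(x , z - x), which is an entry of
    -- `G` left of the diagonal in x < z. The term u_z u_y has weight h(z - y , y), which by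
    -- invariance equals h(z , y - z), an entry of `G` with z > y. The term u_z collects the sum of
    -- h(x , z - x) over x < z.
    below-split : ∀ i → below (λ k l → h (↑⁺ k) (↑⁺ l) * C k l) i ≡
      ∑ i (λ k → G k i) + ∑ i (G i) + E i * ∑ i (λ k → h (↑⁺ k) (↑⁺ i - ↑⁺ k))
    below-split i = begin
      below (λ k l → h (↑⁺ k) (↑⁺ l) * C k l) i
        ≡⟨ below-cong i (λ { k l refl → trans (cong (h (↑⁺ k) (↑⁺ l) *_) (split k l)) (distribute (h (↑⁺ k) (↑⁺ l)) (C k i) (C i l) (E i)) }) ⟩
      below (λ k l → (h (↑⁺ k) (↑⁺ l) * C k i + h (↑⁺ k) (↑⁺ l) * C i l) + E i * h (↑⁺ k) (↑⁺ l)) i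
        ≡⟨ trans (below-+ i _ _) (cong₂ _+_ (below-+ i _ _) (sym (below-*ˡ i (E i) _))) ⟩
      below (λ k l → h (↑⁺ k) (↑⁺ l) * C k i) i + below (λ k l → h (↑⁺ k) (↑⁺ l) * C i l) i
        + E i * below (λ k l → h (↑⁺ k) (↑⁺ l)) i
        ≡⟨ cong₂ _+_ (cong₂ _+_ columns rows) (cong (E i *_) antidiagonal) ⟩
      ∑ i (λ k → G k i) + ∑ i (G i) + E i * ∑ i (λ k → h (↑⁺ k) (↑⁺ i - ↑⁺ k))  ∎
      where
      open ≡-Reasoning
      distribute : ∀ a b c d → a * ((b + c) + d) ≡ (a * b + a * c) + d * a
      distribute = solve 4 (λ a b c d → a :* ((b :+ c) :+ d) := (a :* b :+ a :* c) :+ d :* a) refl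
      columns : below (λ k l → h (↑⁺ k) (↑⁺ l) * C k i) i ≡ ∑ i (λ k → G k i)
      columns = trans (below-cong i λ { k l refl → cong (λ y → h (↑⁺ k) y * C k i) (↑⁺-difference k l) }) (below-∑ i _)
      rows : below (λ k l → h (↑⁺ k) (↑⁺ l) * C i l) i ≡ ∑ i (G i)
      rows = trans (below-flip i _) (trans (below-cong i λ { k l refl → cong (_* C i k)
        (trans (cong (λ x → h x (↑⁺ k)) (↑⁺-difference k l)) (sym (h-invariant (↑⁺ i) (↑⁺ k)))) }) (below-∑ i _))
      antidiagonal : below (λ k l → h (↑⁺ k) (↑⁺ l)) i ≡ ∑ i (λ k → h (↑⁺ k) (↑⁺ i - ↑⁺ k))
      antidiagonal = trans (below-cong i λ { k l refl → cong (h (↑⁺ k)) (↑⁺-difference k l) }) (below-∑ i _)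

  -- The splitting produces the parts x < y and x > y of the sum over `G`; adding the diagonal on
  -- both sides completes them to the full square.
  skoruppa : ∑ n (λ i → ∑ n (λ j → h (↑⁺ i) (↑⁺ j) * C i j)) + ∑ n (λ i → G i i) ≡
    ∑ n (λ i → ∑ n (G i)) + ∑ n (λ i → E i * ∑ i (λ k → h (↑⁺ k) (↑⁺ i - ↑⁺ k)))
  skoruppa = begin
    ∑ n (λ i → ∑ n (λ j → h (↑⁺ i) (↑⁺ j) * C i j)) + ∑ n (λ i → G i i)
      ≡⟨ cong (_+ ∑ n (λ i → G i i)) (∑-triangle n n _ ℕ.≤-refl vanish) ⟩
    ∑ n (below (λ k l → h (↑⁺ k) (↑⁺ l) * C k l)) + ∑ n (λ i → G i i)
      ≡⟨ cong (_+ ∑ n (λ i → G i i)) (trans (∑-cong n (λ i _ → below-split i)) (∑-+ n _ _)) ⟩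
    ∑ n (λ i → ∑ i (λ k → G k i) + ∑ i (G i)) + Z + ∑ n (λ i → G i i)
      ≡⟨ swap (∑ n λ i → ∑ i (λ k → G k i) + ∑ i (G i)) Z (∑ n λ i → G i i) ⟩
    ∑ n (λ i → ∑ i (λ k → G k i) + ∑ i (G i)) + ∑ n (λ i → G i i) + Z
      ≡⟨ cong (_+ Z) (trans (∑-square n G) (∑-+ n _ _)) ⟨
    ∑ n (λ i → ∑ n (G i)) + Z  ∎
    where
    open ≡-Reasoning
    Z = ∑ n (λ i → E i * ∑ i (λ k → h (↑⁺ k) (↑⁺ i - ↑⁺ k)))
    vanish : ∀ i j → n ≤ suc (i ℕ.+ j) → h (↑⁺ i) (↑⁺ j) * C i j ≡ 0ℚ
    vanish i j n≤ = trans (cong (h (↑⁺ i) (↑⁺ j) *_)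
      (u-⊗-low {suc i} (s≤s (ℕ.≤-trans n≤ (ℕ.≤-reflexive (sym (ℕ.+-suc i j))))))) (*-zeroʳ (h (↑⁺ i) (↑⁺ j)))
    swap : ∀ a b c → a + b + c ≡ a + c + b
    swap = solve 3 (λ a b c → a :+ b :+ c := a :+ c :+ b) refl

-- Relations between the products S_i S_j

D-∑-diagonal : ∀ d n → ∑ n (λ i → ↑ suc i ^ℚ suc d * (u (suc i) ⊗ u (suc i)) n) ≡ D (S d) n - S (suc d) n
D-∑-diagonal d n = begin
  ∑ n (λ i → ↑ suc i ^ℚ suc d * (u (suc i) ⊗ u (suc i)) n)
    ≡⟨ ∑-cong n (λ i _ → term i) ⟩
  ∑ n (λ i → ↑ n * (↑ suc i ^ℚ d * u (suc i) n) + - 1ℚ * (↑ suc i ^ℚ suc d * u (suc i) n))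
    ≡⟨ trans (∑-+ n _ _) (cong₂ _+_ (sym (∑-*ˡ n (↑ n) _)) (sym (∑-*ˡ n (- 1ℚ) _))) ⟩
  ↑ n * ∑ n (λ i → ↑ suc i ^ℚ d * u (suc i) n) + - 1ℚ * ∑ n (λ i → ↑ suc i ^ℚ suc d * u (suc i) n)
    ≡⟨ cong₂ (λ a b → ↑ n * a + - 1ℚ * b) (S-∑ d {n} ℕ.≤-refl) (S-∑ (suc d) {n} ℕ.≤-refl) ⟨
  ↑ n * S d n + - 1ℚ * S (suc d) n
    ≡⟨ cong (↑ n * S d n +_) (ℚ.neg-distribˡ-* 1ℚ (S (suc d) n)) ⟨
  ↑ n * S d n + - (1ℚ * S (suc d) n)
    ≡⟨ cong (λ s → ↑ n * S d n - s) (*-identityˡ (S (suc d) n)) ⟩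
  D (S d) n - S (suc d) n  ∎
  where
  open ≡-Reasoning
  open Rat
  rearrange₁ : ∀ x p c → (x * p) * c ≡ p * (x * c)
  rearrange₁ = solve 3 (λ x p c → (x :* p) :* c := p :* (x :* c)) refl
  rearrange₂ : ∀ x p n e → p * (n * e - x * e) ≡ n * (p * e) + - 1ℚ * ((x * p) * e)
  rearrange₂ = solve 4 (λ x p n e → p :* (n :* e :- x :* e) :=
    n :* (p :* e) :+ con (- 1ℚ) :* ((x :* p) :* e)) refl
  term : ∀ i → ↑ suc i ^ℚ suc d * (u (suc i) ⊗ u (suc i)) n ≡
    ↑ n * (↑ suc i ^ℚ d * u (suc i) n) + - 1ℚ * (↑ suc i ^ℚ suc d * u (suc i) n)
  term i = begin
    (x * x ^ℚ d) * (u (suc i) ⊗ u (suc i)) n   ≡⟨ rearrange₁ x (x ^ℚ d) _ ⟩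
    x ^ℚ d * (x * (u (suc i) ⊗ u (suc i)) n)   ≡⟨ cong (x ^ℚ d *_) (trans (sym (κ-⊗ x (u (suc i) ⊗ u (suc i)) n))
                                                  (trans (u-square i n) (cong (λ s → D (u (suc i)) n - s) (κ-⊗ x (u (suc i)) n)))) ⟩
    x ^ℚ d * (↑ n * u (suc i) n - x * u (suc i) n)  ≡⟨ rearrange₂ x (x ^ℚ d) (↑ n) (u (suc i) n) ⟩
    ↑ n * (x ^ℚ d * u (suc i) n) + - 1ℚ * (x * x ^ℚ d * u (suc i) n)  ∎
    where x = ↑ suc i

-- To solve a known relation `a ≡ b` for one of its terms, it suffices to name a multiple `k` for
-- which the second premise is a ring identity. Below, `k` is the reciprocal of the coefficient of
-- the S_k wanted, or -1 for a derivative standing on the left with coefficient 1.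
linear-consequence : ∀ k {a b x y} → a ≡ b → x + k * a ≡ y + k * b → x ≡ y
linear-consequence k {a} {x = x} {y} refl eq = ∙-cancelʳ (k * a) x y eq
  where open import Algebra.Properties.Group ℚ.+-0-group using (∙-cancelʳ)

module ConvolutionRelations where
  open Rat

  -- Substitution acts on syntax, so that a kernel at shifted arguments is again a polynomial whose
  -- normal form can be compared.
  substitute : ∀ {m n} → Polynomial m → Vec (Polynomial n) m → Polynomial n
  substitute (op o p q) θ = op o (substitute p θ) (substitute q θ)
  substitute (con c)    θ = con c
  substitute (var i)    θ = lookup θ i
  substitute (p :^ k)   θ = substitute p θ :^ k
  substitute (:- p)     θ = :- substitute p θ

  ⟦substitute⟧ : ∀ {m n} (p : Polynomial m) (θ : Vec (Polynomial n) m) ρ →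
                 ⟦ substitute p θ ⟧ ρ ≡ ⟦ p ⟧ (Vec.map (λ t → ⟦ t ⟧ ρ) θ)
  ⟦substitute⟧ (op [+] p q) θ ρ = cong₂ _+_ (⟦substitute⟧ p θ ρ) (⟦substitute⟧ q θ ρ)
  ⟦substitute⟧ (op [*] p q) θ ρ = cong₂ _*_ (⟦substitute⟧ p θ ρ) (⟦substitute⟧ q θ ρ)
  ⟦substitute⟧ (con c)      θ ρ = refl
  ⟦substitute⟧ (var i)      θ ρ = sym (Vec.lookup-map i (λ t → ⟦ t ⟧ ρ) θ)
  ⟦substitute⟧ (p :^ k)     θ ρ = cong (_^ℚ k) (⟦substitute⟧ p θ ρ)
  ⟦substitute⟧ (:- p)       θ ρ = cong -_ (⟦substitute⟧ p θ ρ)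

  bivariate : List (ℚ × ℕ × ℕ) → Polynomial 2
  bivariate []                = con 0ℚ
  bivariate ((c , i , j) ∷ B) = con c :* (var zero :^ i :* var (suc zero) :^ j) :+ bivariate B

  univariate : List (ℚ × ℕ) → Polynomial 1
  univariate []            = con 0ℚ
  univariate ((c , i) ∷ L) = con c :* var zero :^ i :+ univariate L

  -- The image of `bivariate B` under x^i y^j ↦ S_i S_j. One coefficient list thus describes both
  -- the kernel difference and the resulting series; `combination` does the same for `univariate`.
  products : List (ℚ × ℕ × ℕ) → ℕ → ℚ
  products []                n = 0ℚ
  products ((c , i , j) ∷ B) n = c * (S i ⊗ S j) n + products B n

  combination : List (ℚ × ℕ) → ℕ → ℚ
  combination []            n = 0ℚ
  combination ((c , i) ∷ L) n = c * S i n + combination L n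

  ∑-bivariate : ∀ B n →
    ∑ n (λ i → ∑ n (λ j → ⟦ bivariate B ⟧ (↑ suc i ∷ ↑ suc j ∷ []) * (u (suc i) ⊗ u (suc j)) n)) ≡ products B n
  ∑-bivariate [] n = ∑-zero n λ i _ → ∑-zero n λ j _ → *-zeroˡ ((u (suc i) ⊗ u (suc j)) n)
  ∑-bivariate ((c , k , l) ∷ B) n = begin
    ∑ n (λ i → ∑ n (λ j → (c * X i j + Y i j) * C i j))
      ≡⟨ ∑-cong n (λ i _ → trans (∑-cong n λ j _ → distribute c (X i j) (Y i j) (C i j))
           (trans (∑-+ n _ _) (cong (_+ ∑ n (λ j → Y i j * C i j)) (sym (∑-*ˡ n c _))))) ⟩
    ∑ n (λ i → c * ∑ n (λ j → X i j * C i j) + ∑ n (λ j → Y i j * C i j))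
      ≡⟨ trans (∑-+ n _ _) (cong (_+ ∑ n (λ i → ∑ n (λ j → Y i j * C i j))) (sym (∑-*ˡ n c _))) ⟩
    c * ∑ n (λ i → ∑ n (λ j → X i j * C i j)) + ∑ n (λ i → ∑ n (λ j → Y i j * C i j))
      ≡⟨ cong₂ _+_ (cong (c *_) (sym (S-⊗-∑ k l n))) (∑-bivariate B n) ⟩
    c * (S k ⊗ S l) n + products B n  ∎
    where
    open ≡-Reasoning
    X Y C : ℕ → ℕ → ℚ
    X i j = ↑ suc i ^ℚ k * ↑ suc j ^ℚ l
    Y i j = ⟦ bivariate B ⟧ (↑ suc i ∷ ↑ suc j ∷ [])
    C i j = (u (suc i) ⊗ u (suc j)) n
    distribute : ∀ a x y c → (a * x + y) * c ≡ a * (x * c) + y * c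
    distribute = solve 4 (λ a x y c → (a :* x :+ y) :* c := a :* (x :* c) :+ y :* c) refl

  ∑-univariate : ∀ L n → ∑ n (λ i → u (suc i) n * ⟦ univariate L ⟧ (↑ suc i ∷ [])) ≡ combination L n
  ∑-univariate [] n = ∑-zero n λ i _ → *-zeroʳ (u (suc i) n)
  ∑-univariate ((c , k) ∷ L) n = begin
    ∑ n (λ i → E i * (c * X i + Y i))
      ≡⟨ trans (∑-cong n λ i _ → distribute (E i) c (X i) (Y i)) (∑-+ n _ _) ⟩
    ∑ n (λ i → c * (X i * E i)) + ∑ n (λ i → E i * Y i)
      ≡⟨ cong₂ _+_ (trans (sym (∑-*ˡ n c _)) (cong (c *_) (sym (S-∑ k ℕ.≤-refl)))) (∑-univariate L n) ⟩
    c * S k n + combination L n  ∎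
    where
    open ≡-Reasoning
    X Y E : ℕ → ℚ
    X i = ↑ suc i ^ℚ k
    Y i = ⟦ univariate L ⟧ (↑ suc i ∷ [])
    E i = u (suc i) n
    distribute : ∀ e c x y → e * (c * x + y) ≡ c * (x * e) + e * y
    distribute = solve 4 (λ e c x y → e :* (c :* x :+ y) := c :* (x :* e) :+ e :* y) refl

  pattern X = var zero
  pattern Y = var (suc zero)

  -- `w` is a discrete antiderivative of x ↦ h(x , z - x), characterised by its value at 0 and its
  -- increments. The sum needed later has z = m + 1, but z occurs in every summand, so the induction
  -- on `m` has to keep it fixed and independent.
  ∑-telescope : (h w : Polynomial 2) →
    T (substitute w (con 0ℚ ∷ Y ∷ []) ≟ᴺ con {2} 0ℚ) →
    T (substitute w (con 1ℚ :+ X ∷ Y ∷ []) ≟ᴺ (w :+ substitute h (con 1ℚ :+ X ∷ Y :- (con 1ℚ :+ X) ∷ []))) →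
    ∀ m z → ∑ m (λ k → ⟦ h ⟧ (↑ suc k ∷ z - ↑ suc k ∷ [])) ≡ ⟦ w ⟧ (↑ m ∷ z ∷ [])
  ∑-telescope h w base step zero    z = trans (∑-0 _) (sym (trans
    (sym (⟦substitute⟧ w (con 0ℚ ∷ Y ∷ []) (0ℚ ∷ z ∷ [])))
    (identity (substitute w (con 0ℚ ∷ Y ∷ [])) (con 0ℚ) base (0ℚ ∷ z ∷ []))))
  ∑-telescope h w base step (suc m) z = begin
    ∑ (suc m) (λ k → ⟦ h ⟧ (↑ suc k ∷ z - ↑ suc k ∷ []))
      ≡⟨ ∑-last m _ ⟩
    ∑ m (λ k → ⟦ h ⟧ (↑ suc k ∷ z - ↑ suc k ∷ [])) + ⟦ h ⟧ (↑ suc m ∷ z - ↑ suc m ∷ [])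
      ≡⟨ cong₂ _+_ (∑-telescope h w base step m z) (cong (λ x → ⟦ h ⟧ (x ∷ z - x ∷ [])) (↑-+ 1 m)) ⟩
    ⟦ w ⟧ ρ + ⟦ h ⟧ (1ℚ + ↑ m ∷ z - (1ℚ + ↑ m) ∷ [])
      ≡⟨ cong (⟦ w ⟧ ρ +_) (⟦substitute⟧ h (con 1ℚ :+ X ∷ Y :- (con 1ℚ :+ X) ∷ []) ρ) ⟨
    ⟦ w :+ substitute h (con 1ℚ :+ X ∷ Y :- (con 1ℚ :+ X) ∷ []) ⟧ ρ
      ≡⟨ identity (substitute w (con 1ℚ :+ X ∷ Y ∷ [])) (w :+ substitute h (con 1ℚ :+ X ∷ Y :- (con 1ℚ :+ X) ∷ [])) step ρ ⟨
    ⟦ substitute w (con 1ℚ :+ X ∷ Y ∷ []) ⟧ ρ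
      ≡⟨ ⟦substitute⟧ w (con 1ℚ :+ X ∷ Y ∷ []) ρ ⟩
    ⟦ w ⟧ (1ℚ + ↑ m ∷ z ∷ [])
      ≡⟨ cong (λ x → ⟦ w ⟧ (x ∷ z ∷ [])) (↑-+ 1 m) ⟨
    ⟦ w ⟧ (↑ suc m ∷ z ∷ [])  ∎
    where
    open ≡-Reasoning
    ρ = ↑ m ∷ z ∷ []

  -- The implicit premises are the polynomial facts behind one application of `skoruppa`:
  -- invariance; h(x , y) - h(x , y - x) = B; h(x , 0) = e x^(d + 1); the two conditions making `w`
  -- the partial sum; and w(z - 1 , z) + e z^(d + 1) = L(z), stated with z = 1 + X. The summand e
  -- z^(d + 1) is the S-part of the diagonal, moved to the right.
  convolution-relation : (h w : Polynomial 2) (B : List (ℚ × ℕ × ℕ)) (L : List (ℚ × ℕ)) (d : ℕ) (e : ℚ) →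
    {T (substitute h (X ∷ Y :- X ∷ []) ≟ᴺ substitute h (X :- Y ∷ Y ∷ []))} →
    {T (h ≟ᴺ (bivariate B :+ substitute h (X ∷ Y :- X ∷ [])))} →
    {T (substitute h (X ∷ X :- X ∷ []) ≟ᴺ (con {1} e :* X :^ suc d))} →
    {T (substitute w (con 0ℚ ∷ Y ∷ []) ≟ᴺ con {2} 0ℚ)} →
    {T (substitute w (con 1ℚ :+ X ∷ Y ∷ []) ≟ᴺ (w :+ substitute h (con 1ℚ :+ X ∷ Y :- (con 1ℚ :+ X) ∷ [])))} →
    {T ((substitute w (X ∷ con 1ℚ :+ X ∷ []) :+ con {1} e :* (con 1ℚ :+ X) :^ suc d)
        ≟ᴺ substitute (univariate L) (con 1ℚ :+ X ∷ []))} →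
    ∀ n → products B n + e * D (S d) n ≡ combination L n
  convolution-relation h w B L d e {invariant} {difference} {diagonal} {base} {step} {total} n = begin
    products B n + e * D (S d) n
      ≡⟨ solve-for-products (∑∑ f) Gs (products B n) (e * D (S d) n) (e * S (suc d) n) Ws
           left skoruppa′ ⟩
    Ws + e * S (suc d) n
      ≡⟨ right ⟩
    combination L n  ∎
    where
    open ≡-Reasoning
    C f G : ℕ → ℕ → ℚ
    C i j = (u (suc i) ⊗ u (suc j)) n
    f i j = ⟦ h ⟧ (↑ suc i ∷ ↑ suc j ∷ []) * C i j
    G i j = ⟦ h ⟧ (↑ suc i ∷ ↑ suc j - ↑ suc i ∷ []) * C i j
    W : ℕ → ℚ
    W i = ∑ i (λ k → ⟦ h ⟧ (↑ suc k ∷ ↑ suc i - ↑ suc k ∷ []))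
    ∑∑ : (ℕ → ℕ → ℚ) → ℚ
    ∑∑ F = ∑ n (λ i → ∑ n (F i))
    Gs = ∑∑ G
    Ws = ∑ n (λ i → u (suc i) n * W i)

    invariance : ∀ x y → ⟦ h ⟧ (x ∷ y - x ∷ []) ≡ ⟦ h ⟧ (x - y ∷ y ∷ [])
    invariance x y = begin
      ⟦ h ⟧ (x ∷ y - x ∷ [])                            ≡⟨ ⟦substitute⟧ h (X ∷ Y :- X ∷ []) (x ∷ y ∷ []) ⟨
      ⟦ substitute h (X ∷ Y :- X ∷ []) ⟧ (x ∷ y ∷ [])   ≡⟨ identity (substitute h (X ∷ Y :- X ∷ [])) (substitute h (X :- Y ∷ Y ∷ [])) invariant (x ∷ y ∷ []) ⟩
      ⟦ substitute h (X :- Y ∷ Y ∷ []) ⟧ (x ∷ y ∷ [])   ≡⟨ ⟦substitute⟧ h (X :- Y ∷ Y ∷ []) (x ∷ y ∷ []) ⟩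
      ⟦ h ⟧ (x - y ∷ y ∷ [])                            ∎

    left : ∑∑ f ≡ products B n + Gs
    left = begin
      ∑∑ f
        ≡⟨ ∑-cong n (λ i _ → trans (∑-cong n λ j _ → term (↑ suc i) (↑ suc j) (C i j)) (∑-+ n _ _)) ⟩
      ∑ n (λ i → ∑ n (λ j → ⟦ bivariate B ⟧ (↑ suc i ∷ ↑ suc j ∷ []) * C i j) + ∑ n (G i))
        ≡⟨ trans (∑-+ n _ _) (cong (_+ Gs) (∑-bivariate B n)) ⟩
      products B n + Gs  ∎
      where
      term : ∀ x y c → ⟦ h ⟧ (x ∷ y ∷ []) * c ≡
        ⟦ bivariate B ⟧ (x ∷ y ∷ []) * c + ⟦ h ⟧ (x ∷ y - x ∷ []) * c
      term x y c = trans (cong (_* c) (trans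
          (identity h (bivariate B :+ substitute h (X ∷ Y :- X ∷ [])) difference (x ∷ y ∷ []))
          (cong (⟦ bivariate B ⟧ (x ∷ y ∷ []) +_) (⟦substitute⟧ h (X ∷ Y :- X ∷ []) (x ∷ y ∷ [])))))
        (*-distribʳ-+ c (⟦ bivariate B ⟧ (x ∷ y ∷ [])) (⟦ h ⟧ (x ∷ y - x ∷ [])))

    diagonal-sum : ∑ n (λ i → G i i) ≡ e * D (S d) n - e * S (suc d) n
    diagonal-sum = begin
      ∑ n (λ i → G i i)                            ≡⟨ ∑-cong n (λ i _ → term (↑ suc i) (C i i)) ⟩
      ∑ n (λ i → e * (↑ suc i ^ℚ suc d * C i i))    ≡⟨ ∑-*ˡ n e _ ⟨
      e * ∑ n (λ i → ↑ suc i ^ℚ suc d * C i i)      ≡⟨ cong (e *_) (D-∑-diagonal d n) ⟩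
      e * (D (S d) n - S (suc d) n)                ≡⟨ distribute e (D (S d) n) (S (suc d) n) ⟩
      e * D (S d) n - e * S (suc d) n              ∎
      where
      distribute : ∀ e a b → e * (a - b) ≡ e * a - e * b
      distribute = solve 3 (λ e a b → e :* (a :- b) := e :* a :- e :* b) refl
      term : ∀ x c → ⟦ h ⟧ (x ∷ x - x ∷ []) * c ≡ e * (x ^ℚ suc d * c)
      term x c = trans (cong (_* c) (trans (sym (⟦substitute⟧ h (X ∷ X :- X ∷ []) (x ∷ [])))
        (identity (substitute h (X ∷ X :- X ∷ [])) (con e :* X :^ suc d) diagonal (x ∷ []))))
        (*-assoc e (x ^ℚ suc d) c)

    skoruppa′ : ∑∑ f + (e * D (S d) n - e * S (suc d) n) ≡ Gs + Ws
    skoruppa′ = trans (cong (∑∑ f +_) (sym diagonal-sum)) (skoruppa (λ x y → ⟦ h ⟧ (x ∷ y ∷ [])) invariance n)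

    right : Ws + e * S (suc d) n ≡ combination L n
    right = begin
      Ws + e * S (suc d) n
        ≡⟨ cong (λ s → Ws + e * s) (S-∑ (suc d) {n} ℕ.≤-refl) ⟩
      Ws + e * ∑ n (λ i → ↑ suc i ^ℚ suc d * u (suc i) n)
        ≡⟨ trans (cong (Ws +_) (∑-*ˡ n e _)) (sym (∑-+ n _ _)) ⟩
      ∑ n (λ i → u (suc i) n * W i + e * (↑ suc i ^ℚ suc d * u (suc i) n))
        ≡⟨ ∑-cong n (λ i _ → trans (collect (u (suc i) n) (W i) e (↑ suc i ^ℚ suc d)) (cong (u (suc i) n *_) (term i))) ⟩
      ∑ n (λ i → u (suc i) n * ⟦ univariate L ⟧ (↑ suc i ∷ []))
        ≡⟨ ∑-univariate L n ⟩
      combination L n  ∎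
      where
      collect : ∀ a w e x → a * w + e * (x * a) ≡ a * (w + e * x)
      collect = solve 4 (λ a w e x → a :* w :+ e :* (x :* a) := a :* (w :+ e :* x)) refl
      term : ∀ i → W i + e * ↑ suc i ^ℚ suc d ≡ ⟦ univariate L ⟧ (↑ suc i ∷ [])
      term i = begin
        W i + e * ↑ suc i ^ℚ suc d
          ≡⟨ cong (_+ e * ↑ suc i ^ℚ suc d) (∑-telescope h w base step i (↑ suc i)) ⟩
        ⟦ w ⟧ (↑ i ∷ ↑ suc i ∷ []) + e * ↑ suc i ^ℚ suc d
          ≡⟨ cong (λ x → ⟦ w ⟧ (↑ i ∷ x ∷ []) + e * x ^ℚ suc d) (↑-+ 1 i) ⟩
        ⟦ w ⟧ (↑ i ∷ 1ℚ + ↑ i ∷ []) + e * (1ℚ + ↑ i) ^ℚ suc d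
          ≡⟨ cong (_+ e * (1ℚ + ↑ i) ^ℚ suc d) (⟦substitute⟧ w (X ∷ con 1ℚ :+ X ∷ []) (↑ i ∷ [])) ⟨
        ⟦ substitute w (X ∷ con 1ℚ :+ X ∷ []) :+ con e :* (con 1ℚ :+ X) :^ suc d ⟧ (↑ i ∷ [])
          ≡⟨ identity (substitute w (X ∷ con 1ℚ :+ X ∷ []) :+ con e :* (con 1ℚ :+ X) :^ suc d)
               (substitute (univariate L) (con 1ℚ :+ X ∷ [])) total (↑ i ∷ []) ⟩
        ⟦ substitute (univariate L) (con 1ℚ :+ X ∷ []) ⟧ (↑ i ∷ [])
          ≡⟨ ⟦substitute⟧ (univariate L) (con 1ℚ :+ X ∷ []) (↑ i ∷ []) ⟩
        ⟦ univariate L ⟧ (1ℚ + ↑ i ∷ [])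
          ≡⟨ cong (λ x → ⟦ univariate L ⟧ (x ∷ [])) (↑-+ 1 i) ⟨
        ⟦ univariate L ⟧ (↑ suc i ∷ [])  ∎

    solve-for-products : ∀ s g p a b w → s ≡ p + g → s + (a - b) ≡ g + w → p + a ≡ w + b
    solve-for-products s g p a b w refl eq = begin
      p + a                          ≡⟨ before p g a b ⟩
      ((p + g) + (a - b)) + (b - g)  ≡⟨ cong (_+ (b - g)) eq ⟩
      (g + w) + (b - g)              ≡⟨ after g w b ⟩
      w + b                          ∎
      where
      before : ∀ p g a b → p + a ≡ ((p + g) + (a - b)) + (b - g)
      before = solve 4 (λ p g a b → p :+ a := ((p :+ g) :+ (a :- b)) :+ (b :- g)) refl
      after : ∀ g w b → (g + w) + (b - g) ≡ w + b
      after = solve 3 (λ g w b → (g :+ w) :+ (b :- g) := w :+ b) refl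

  -- The invariant kernels and their relations

  open import Agda.Builtin.FromNat using (fromNat)
  open import Data.Unit using (tt)

  -- Faulhaber's formulas for ∑ xᵏ over 1 ≤ x ≤ m, with m = X; the value is junk for k > 8
  powerSum : ℕ → Polynomial 2
  powerSum 0 = X
  powerSum 1 = con (1 ÷ 2) :* X :^ 2 :+ con (1 ÷ 2) :* X
  powerSum 2 = con (1 ÷ 3) :* X :^ 3 :+ con (1 ÷ 2) :* X :^ 2 :+ con (1 ÷ 6) :* X
  powerSum 3 = con (1 ÷ 4) :* X :^ 4 :+ con (1 ÷ 2) :* X :^ 3 :+ con (1 ÷ 4) :* X :^ 2
  powerSum 4 = con (1 ÷ 5) :* X :^ 5 :+ con (1 ÷ 2) :* X :^ 4 :+ con (1 ÷ 3) :* X :^ 3 :- con (1 ÷ 30) :* X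
  powerSum 5 = con (1 ÷ 6) :* X :^ 6 :+ con (1 ÷ 2) :* X :^ 5 :+ con (5 ÷ 12) :* X :^ 4 :- con (1 ÷ 12) :* X :^ 2
  powerSum 6 = con (1 ÷ 7) :* X :^ 7 :+ con (1 ÷ 2) :* X :^ 6 :+ con (1 ÷ 2) :* X :^ 5 :- con (1 ÷ 6) :* X :^ 3 :+ con (1 ÷ 42) :* X
  powerSum 7 = con (1 ÷ 8) :* X :^ 8 :+ con (1 ÷ 2) :* X :^ 7 :+ con (7 ÷ 12) :* X :^ 6 :- con (7 ÷ 24) :* X :^ 4 :+ con (1 ÷ 12) :* X :^ 2
  powerSum 8 = con (1 ÷ 9) :* X :^ 9 :+ con (1 ÷ 2) :* X :^ 8 :+ con (2 ÷ 3) :* X :^ 7 :- con (7 ÷ 15) :* X :^ 5 :+ con (2 ÷ 9) :* X :^ 3 :- con (1 ÷ 30) :* X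
  powerSum _ = con 0

  -- ∑ (x(z - x))ʳ over 1 ≤ x ≤ m, with m = X and z = Y; the value is junk for r > 4
  productSum : ℕ → Polynomial 2
  productSum 0 = powerSum 0
  productSum 1 = Y :* powerSum 1 :- powerSum 2
  productSum 2 = Y :^ 2 :* powerSum 2 :- con 2 :* Y :* powerSum 3 :+ powerSum 4
  productSum 3 = Y :^ 3 :* powerSum 3 :- con 3 :* Y :^ 2 :* powerSum 4 :+ con 3 :* Y :* powerSum 5 :- powerSum 6
  productSum 4 = Y :^ 4 :* powerSum 4 :- con 4 :* Y :^ 3 :* powerSum 5 :+ con 6 :* Y :^ 2 :* powerSum 6 :- con 4 :* Y :* powerSum 7 :+ powerSum 8
  productSum _ = con 0

  -- In terms of z = x + y, the invariants are N = x² + xy + y² = z² - xy and J = (xyz)²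
  kernel : List (ℚ × ℕ × ℕ) → Polynomial 2
  kernel []                = con 0
  kernel ((a , s , r) ∷ H) = con a :* (X :+ Y) :^ s :* (X :* Y) :^ r :+ kernel H

  -- On the line x + y = z a term z^s (xy)^r becomes z^s (x(z - x))^r. Its first factor does not
  -- depend on the summation variable x.
  kernelSum : List (ℚ × ℕ × ℕ) → Polynomial 2
  kernelSum []                = con 0
  kernelSum ((a , s , r) ∷ H) = con a :* Y :^ s :* productSum r :+ kernelSum H

  relation : (H B : List (ℚ × ℕ × ℕ)) (L : List (ℚ × ℕ)) (d : ℕ) (e : ℚ) → _
  relation H = convolution-relation (kernel H) (kernelSum H)

  -- The kernel is J = z² (xy)². Twice its part odd in y is 4 x³ y³, and it vanishes at y = 0, so e
  -- = 0.
  S₇-product : ∀ n → S 7 n ≡ S 3 n + 120 * (S 3 ⊗ S 3) n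
  S₇-product n = linear-consequence 30
    (relation ((1 , 2 , 2) ∷ []) ((4 , 3 , 3) ∷ []) ((- 1 ÷ 30 , 3) ∷ (1 ÷ 30 , 7) ∷ []) 0 0 n)
    (identity
      (var 2F :+ con 30 :* (con 4 :* var 1F :+ con 0 :+ con 0 :* var 3F))
      (var 0F :+ con 120 :* var 1F :+ con 30 :* (con (- 1 ÷ 30) :* var 0F :+ (con (1 ÷ 30) :* var 2F :+ con 0)))
      _ (S 3 n ∷ (S 3 ⊗ S 3) n ∷ S 7 n ∷ D (S 0) n ∷ []))

  -- The kernel is NJ = z⁴ (xy)² - z² (xy)³.
  S₉-product : ∀ n → S 9 n ≡ 5040 ÷ 11 * (S 3 ⊗ S 5) n + - 10 ÷ 11 * S 3 n + 21 ÷ 11 * S 5 n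
  S₉-product n = linear-consequence (420 ÷ 11)
    (relation ((1 , 4 , 2) ∷ (- 1 , 2 , 3) ∷ []) ((6 , 3 , 5) ∷ (6 , 5 , 3) ∷ [])
      ((1 ÷ 42 , 3) ∷ (- 1 ÷ 20 , 5) ∷ (11 ÷ 420 , 9) ∷ []) 0 0 n)
    (trans (cong (λ p → S 9 n + 420 ÷ 11 * (6 * (S 3 ⊗ S 5) n + (6 * p + 0) + 0 * D (S 0) n)) (⊗-comm (S 5) (S 3) n))
    (identity
      (var 3F :+ con (420 ÷ 11) :* (con 6 :* var 2F :+ (con 6 :* var 2F :+ con 0) :+ con 0 :* var 4F))
      (con (5040 ÷ 11) :* var 2F :+ con (- 10 ÷ 11) :* var 0F :+ con (21 ÷ 11) :* var 1F :+
        con (420 ÷ 11) :* (con (1 ÷ 42) :* var 0F :+ (con (- 1 ÷ 20) :* var 1F :+ (con (11 ÷ 420) :* var 3F :+ con 0))))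
      _ (S 3 n ∷ S 5 n ∷ (S 3 ⊗ S 5) n ∷ S 9 n ∷ D (S 0) n ∷ [])))

  -- The kernel is N²J = z⁶ (xy)² - 2 z⁴ (xy)³ + z² (xy)⁴.
  S₁₁-product : ∀ n → S 11 n ≡ 10080 ÷ 13 * (S 3 ⊗ S 7) n + 12600 ÷ 13 * (S 5 ⊗ S 5) n
    + 21 ÷ 13 * S 3 n + - 50 ÷ 13 * S 5 n + 42 ÷ 13 * S 7 n
  S₁₁-product n = linear-consequence (630 ÷ 13)
    (relation ((1 , 6 , 2) ∷ (- 2 , 4 , 3) ∷ (1 , 2 , 4) ∷ []) ((8 , 3 , 7) ∷ (20 , 5 , 5) ∷ (8 , 7 , 3) ∷ [])
      ((- 1 ÷ 30 , 3) ∷ (5 ÷ 63 , 5) ∷ (- 1 ÷ 15 , 7) ∷ (13 ÷ 630 , 11) ∷ []) 0 0 n)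
    (trans (cong (λ p → S 11 n + 630 ÷ 13 * (8 * (S 3 ⊗ S 7) n + (20 * (S 5 ⊗ S 5) n + (8 * p + 0)) + 0 * D (S 0) n))
      (⊗-comm (S 7) (S 3) n))
    (identity
      (var 5F :+ con (630 ÷ 13) :* (con 8 :* var 3F :+ (con 20 :* var 4F :+ (con 8 :* var 3F :+ con 0)) :+ con 0 :* var 6F))
      (con (10080 ÷ 13) :* var 3F :+ con (12600 ÷ 13) :* var 4F :+ con (21 ÷ 13) :* var 0F :+ con (- 50 ÷ 13) :* var 1F :+
        con (42 ÷ 13) :* var 2F :+ con (630 ÷ 13) :* (con (- 1 ÷ 30) :* var 0F :+ (con (5 ÷ 63) :* var 1F :+
          (con (- 1 ÷ 15) :* var 2F :+ (con (13 ÷ 630) :* var 5F :+ con 0)))))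
      _ (S 3 n ∷ S 5 n ∷ S 7 n ∷ (S 3 ⊗ S 7) n ∷ (S 5 ⊗ S 5) n ∷ S 11 n ∷ D (S 0) n ∷ [])))

  -- At y = 0 the kernel N^k equals x^(2k), so e = 1 and the diagonal yields the derivative of S_(2k
  -- - 1): d = 1, 3, 5 for k = 1, 2, 3.
  D-S₁ : ∀ n → D (S 1) n ≡ 1 ÷ 6 * S 1 n + 5 ÷ 6 * S 3 n + - 2 * (S 1 ⊗ S 1) n
  D-S₁ n = linear-consequence (- 1)
    (relation ((1 , 2 , 0) ∷ (- 1 , 0 , 1) ∷ []) ((2 , 1 , 1) ∷ []) ((1 ÷ 6 , 1) ∷ (5 ÷ 6 , 3) ∷ []) 1 1 n)
    (identity
      (var 3F :+ con (- 1) :* (con 2 :* var 2F :+ con 0 :+ con 1 :* var 3F))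
      (con (1 ÷ 6) :* var 0F :+ con (5 ÷ 6) :* var 1F :+ con (- 2) :* var 2F :+
        con (- 1) :* (con (1 ÷ 6) :* var 0F :+ (con (5 ÷ 6) :* var 1F :+ con 0)))
      _ (S 1 n ∷ S 3 n ∷ (S 1 ⊗ S 1) n ∷ D (S 1) n ∷ []))

  D-S₃ : ∀ n → D (S 3) n ≡ - 1 ÷ 30 * S 1 n + 1 ÷ 3 * S 3 n + 7 ÷ 10 * S 5 n + - 8 * (S 1 ⊗ S 3) n
  D-S₃ n = linear-consequence (- 1)
    (relation ((1 , 4 , 0) ∷ (- 2 , 2 , 1) ∷ (1 , 0 , 2) ∷ []) ((4 , 1 , 3) ∷ (4 , 3 , 1) ∷ [])
      ((- 1 ÷ 30 , 1) ∷ (1 ÷ 3 , 3) ∷ (7 ÷ 10 , 5) ∷ []) 3 1 n)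
    (trans (cong (λ p → D (S 3) n + - 1 * (4 * (S 1 ⊗ S 3) n + (4 * p + 0) + 1 * D (S 3) n)) (⊗-comm (S 3) (S 1) n))
    (identity
      (var 4F :+ con (- 1) :* (con 4 :* var 3F :+ (con 4 :* var 3F :+ con 0) :+ con 1 :* var 4F))
      (con (- 1 ÷ 30) :* var 0F :+ con (1 ÷ 3) :* var 1F :+ con (7 ÷ 10) :* var 2F :+ con (- 8) :* var 3F :+
        con (- 1) :* (con (- 1 ÷ 30) :* var 0F :+ (con (1 ÷ 3) :* var 1F :+ (con (7 ÷ 10) :* var 2F :+ con 0))))
      _ (S 1 n ∷ S 3 n ∷ S 5 n ∷ (S 1 ⊗ S 3) n ∷ D (S 3) n ∷ [])))

  -- The kernel N³ leaves S₃ S₃ on the right. Eliminating it by `S₇-product` would give the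
  -- classical D S₅ = S₁ / 42 + S₅ / 2 + 10 S₇ / 21 - 12 S₁ S₅.
  D-S₅ : ∀ n → D (S 5) n ≡ 1 ÷ 42 * S 1 n + - 7 ÷ 60 * S 3 n + 1 ÷ 2 * S 5 n + 83 ÷ 140 * S 7 n
    + - 12 * (S 1 ⊗ S 5) n + - 14 * (S 3 ⊗ S 3) n
  D-S₅ n = linear-consequence (- 1)
    (relation ((1 , 6 , 0) ∷ (- 3 , 4 , 1) ∷ (3 , 2 , 2) ∷ (- 1 , 0 , 3) ∷ [])
      ((6 , 1 , 5) ∷ (14 , 3 , 3) ∷ (6 , 5 , 1) ∷ [])
      ((1 ÷ 42 , 1) ∷ (- 7 ÷ 60 , 3) ∷ (1 ÷ 2 , 5) ∷ (83 ÷ 140 , 7) ∷ []) 5 1 n)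
    (trans (cong (λ p → D (S 5) n + - 1 * (6 * (S 1 ⊗ S 5) n + (14 * (S 3 ⊗ S 3) n + (6 * p + 0)) + 1 * D (S 5) n))
      (⊗-comm (S 5) (S 1) n))
    (identity
      (var 6F :+ con (- 1) :* (con 6 :* var 4F :+ (con 14 :* var 5F :+ (con 6 :* var 4F :+ con 0)) :+ con 1 :* var 6F))
      (con (1 ÷ 42) :* var 0F :+ con (- 7 ÷ 60) :* var 1F :+ con (1 ÷ 2) :* var 2F :+ con (83 ÷ 140) :* var 3F :+
        con (- 12) :* var 4F :+ con (- 14) :* var 5F :+ con (- 1) :* (con (1 ÷ 42) :* var 0F :+
          (con (- 7 ÷ 60) :* var 1F :+ (con (1 ÷ 2) :* var 2F :+ (con (83 ÷ 140) :* var 3F :+ con 0)))))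
      _ (S 1 n ∷ S 3 n ∷ S 5 n ∷ S 7 n ∷ (S 1 ⊗ S 5) n ∷ (S 3 ⊗ S 3) n ∷ D (S 5) n ∷ [])))

open ConvolutionRelations

-- Quasimodular forms

module Forms where
  open Ser
  open import Agda.Builtin.FromNat using (fromNat)
  open import Data.Unit using (tt)

  -- Polynomials in S₁ = (1 - E₂) / 24, S₃ = (E₄ - 1) / 240 and S₅ = (1 - E₆) / 504
  Form : Set
  Form = Polynomial 3

  infixr 9 _∙_
  _∙_ : ℚ → Form → Form
  c ∙ f = con c :* f

  pattern s₁ = var zero
  pattern s₃ = var (suc zero)
  pattern s₅ = var (suc (suc zero))

  -- E₈ = E₄², E₁₀ = E₄ E₆ and 691 E₁₂ = 441 E₄³ + 250 E₆²
  s₇ s₉ s₁₁ : Form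
  s₇  = s₃ :+ 120 ∙ (s₃ :* s₃)
  s₉  = (5040 ÷ 11) ∙ (s₃ :* s₅) :+ (- 10 ÷ 11) ∙ s₃ :+ (21 ÷ 11) ∙ s₅
  s₁₁ = (10080 ÷ 13) ∙ (s₃ :* s₇) :+ (12600 ÷ 13) ∙ (s₅ :* s₅)
    :+ (21 ÷ 13) ∙ s₃ :+ (- 50 ÷ 13) ∙ s₅ :+ (42 ÷ 13) ∙ s₇

  -- The values at s₁, s₃, s₅ are Ramanujan's differential equations for E₂, E₄, E₆
  ∂ : Form → Form
  ∂ (op [+] f g)  = ∂ f :+ ∂ g
  ∂ (op [*] f g)  = ∂ f :* g :+ f :* ∂ g
  ∂ (con c)       = con 0
  ∂ s₁            = (1 ÷ 6) ∙ s₁ :+ (5 ÷ 6) ∙ s₃ :+ (- 2) ∙ (s₁ :* s₁)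
  ∂ s₃            = (- 1 ÷ 30) ∙ s₁ :+ (1 ÷ 3) ∙ s₃ :+ (7 ÷ 10) ∙ s₅ :+ (- 8) ∙ (s₁ :* s₃)
  ∂ s₅            = (1 ÷ 42) ∙ s₁ :+ (- 7 ÷ 60) ∙ s₃ :+ (1 ÷ 2) ∙ s₅ :+ (83 ÷ 140) ∙ s₇
    :+ (- 12) ∙ (s₁ :* s₅) :+ (- 14) ∙ (s₃ :* s₃)
  ∂ (f :^ zero)   = con 0
  ∂ (f :^ suc k)  = ∂ f :* f :^ k :+ f :* ∂ (f :^ k)
  ∂ (:- f)        = :- ∂ f

  qExp : Form → ℕ → ℚ
  qExp f = ⟦ f ⟧ (S 1 ∷ S 3 ∷ S 5 ∷ [])

  -- In `qExp` a scalar multiple is a convolution with a constant series. Here the outer linear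
  -- combination is evaluated coefficientwise instead, so that the relations proved above are
  -- definitionally statements about `value`.
  value : Form → ℕ → ℚ
  value (op [+] f g)       n = value f n + value g n
  value (op [*] (con c) g) n = c * value g n
  value f                  n = qExp f n

  value-qExp : ∀ f n → value f n ≡ qExp f n
  value-qExp (op [+] f g)              n = cong₂ _+_ (value-qExp f n) (value-qExp g n)
  value-qExp (op [*] (con c) g)        n = trans (cong (c *_) (value-qExp g n)) (sym (κ-⊗ c (qExp g) n))
  value-qExp (op [*] (op _ _ _) g)     n = refl
  value-qExp (op [*] (var _) g)        n = refl
  value-qExp (op [*] (_ :^ _) g)       n = refl
  value-qExp (op [*] (:- _) g)         n = refl
  value-qExp (con _)                   n = refl
  value-qExp (var _)                   n = refl
  value-qExp (_ :^ _)                  n = refl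
  value-qExp (:- _)                    n = refl

  S₇-qExp : S 7 ≈ qExp s₇
  S₇-qExp n = trans (S₇-product n) (value-qExp s₇ n)

  S₉-qExp : S 9 ≈ qExp s₉
  S₉-qExp n = trans (S₉-product n) (value-qExp s₉ n)

  S₁₁-qExp : S 11 ≈ qExp s₁₁
  S₁₁-qExp n = begin
    S 11 n
      ≡⟨ S₁₁-product n ⟩
    10080 ÷ 13 * (S 3 ⊗ S 7) n + 12600 ÷ 13 * (S 5 ⊗ S 5) n + 21 ÷ 13 * S 3 n + - 50 ÷ 13 * S 5 n + 42 ÷ 13 * S 7 n
      ≡⟨ cong₂ (λ p q → 10080 ÷ 13 * p + 12600 ÷ 13 * (S 5 ⊗ S 5) n + 21 ÷ 13 * S 3 n + - 50 ÷ 13 * S 5 n + 42 ÷ 13 * q)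
           (A.*-congˡ {S 3} S₇-qExp n) (S₇-product n) ⟩
    value s₁₁ n
      ≡⟨ value-qExp s₁₁ n ⟩
    qExp s₁₁ n  ∎
    where open ≡-Reasoning

  ∂s₁-qExp : qExp (∂ s₁) ≈ D (S 1)
  ∂s₁-qExp n = sym (trans (D-S₁ n) (value-qExp (∂ s₁) n))

  ∂s₃-qExp : qExp (∂ s₃) ≈ D (S 3)
  ∂s₃-qExp n = sym (trans (D-S₃ n) (value-qExp (∂ s₃) n))

  ∂s₅-qExp : qExp (∂ s₅) ≈ D (S 5)
  ∂s₅-qExp n = sym (begin
    D (S 5) n
      ≡⟨ D-S₅ n ⟩
    1 ÷ 42 * S 1 n + - 7 ÷ 60 * S 3 n + 1 ÷ 2 * S 5 n + 83 ÷ 140 * S 7 n + - 12 * (S 1 ⊗ S 5) n + - 14 * (S 3 ⊗ S 3) n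
      ≡⟨ cong (λ p → 1 ÷ 42 * S 1 n + - 7 ÷ 60 * S 3 n + 1 ÷ 2 * S 5 n + 83 ÷ 140 * p + - 12 * (S 1 ⊗ S 5) n + - 14 * (S 3 ⊗ S 3) n)
           (S₇-product n) ⟩
    value (∂ s₅) n
      ≡⟨ value-qExp (∂ s₅) n ⟩
    qExp (∂ s₅) n  ∎)
    where open ≡-Reasoning

  -- Both sides are derivations that kill constants, so all content lies in the three generators,
  -- where it is Ramanujan's equations.
  ∂-qExp : ∀ f → qExp (∂ f) ≈ D (qExp f)
  ∂-qExp (op [+] f g) = A.trans (A.+-cong (∂-qExp f) (∂-qExp g)) (A.sym (D-⊕ (qExp f) (qExp g)))
  ∂-qExp (op [*] f g) = A.trans
    (A.+-cong (A.*-congʳ {qExp g} (∂-qExp f)) (A.*-congˡ {qExp f} (∂-qExp g)))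
    (A.sym (D-⊗ (qExp f) (qExp g)))
  ∂-qExp (con c)      = A.sym (λ n → trans (D-κ c n) (κ-0 n))
  ∂-qExp s₁           = ∂s₁-qExp
  ∂-qExp s₃           = ∂s₃-qExp
  ∂-qExp s₅           = ∂s₅-qExp
  ∂-qExp (f :^ zero)  = A.sym (λ n → trans (D-κ 1 n) (κ-0 n))
  ∂-qExp (f :^ suc k) = A.trans
    (A.+-cong (A.*-congʳ {qExp (f :^ k)} (∂-qExp f)) (A.*-congˡ {qExp f} (∂-qExp (f :^ k))))
    (A.sym (D-⊗ (qExp f) (qExp (f :^ k))))
  ∂-qExp (:- f)       = A.trans (A.-‿cong (∂-qExp f)) (A.sym (D-neg (qExp f)))

  -- Syntax close to the shape of the nine identities, with the higher S_k and iterated derivatives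
  -- of products as primitives; `form` reduces each expression to a polynomial in S₁, S₃, S₅.
  data Expression : Set where
    S₁ S₃ S₅ S₇ S₉ S₁₁ : Expression
    𝐃                  : Expression → Expression
    _⟨+⟩_ _⟨*⟩_        : Expression → Expression → Expression
    _⟨∙⟩_              : ℚ → Expression → Expression

  infixl 5 _⟨+⟩_
  infixr 6 _⟨∙⟩_
  infixl 7 _⟨*⟩_

  ⟪_⟫ : Expression → ℕ → ℚ
  ⟪ S₁ ⟫      = S 1
  ⟪ S₃ ⟫      = S 3
  ⟪ S₅ ⟫      = S 5
  ⟪ S₇ ⟫      = S 7
  ⟪ S₉ ⟫      = S 9
  ⟪ S₁₁ ⟫     = S 11
  ⟪ 𝐃 e ⟫     = D ⟪ e ⟫
  ⟪ e ⟨+⟩ f ⟫ = ⟪ e ⟫ ⊕ ⟪ f ⟫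
  ⟪ e ⟨*⟩ f ⟫ = ⟪ e ⟫ ⊗ ⟪ f ⟫
  ⟪ c ⟨∙⟩ e ⟫ = λ n → c * ⟪ e ⟫ n

  form : Expression → Form
  form S₁        = s₁
  form S₃        = s₃
  form S₅        = s₅
  form S₇        = s₇
  form S₉        = s₉
  form S₁₁       = s₁₁
  form (𝐃 e)     = ∂ (form e)
  form (e ⟨+⟩ f) = form e :+ form f
  form (e ⟨*⟩ f) = form e :* form f
  form (c ⟨∙⟩ e) = c ∙ form e

  form-correct : ∀ e → ⟪ e ⟫ ≈ qExp (form e)
  form-correct S₁        = A.refl
  form-correct S₃        = A.refl
  form-correct S₅        = A.refl
  form-correct S₇        = S₇-qExp
  form-correct S₉        = S₉-qExp
  form-correct S₁₁       = S₁₁-qExp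
  form-correct (𝐃 e)     = A.trans (D-cong (form-correct e)) (A.sym (∂-qExp (form e)))
  form-correct (e ⟨+⟩ f) = A.+-cong (form-correct e) (form-correct f)
  form-correct (e ⟨*⟩ f) = A.*-cong (form-correct e) (form-correct f)
  form-correct (c ⟨∙⟩ e) n = trans (cong (c *_) (form-correct e n)) (sym (κ-⊗ c (qExp (form e)) n))

  -- (E₄³ - E₆²) / 1728
  discriminant : Form
  discriminant = (1 ÷ 1728) ∙ ((con 1 :+ 240 ∙ s₃) :^ 3 :- (con 1 :- 504 ∙ s₅) :^ 2)

  -- By D E₄ = (E₂ E₄ - E₆) / 3 and D E₆ = (E₂ E₆ - E₄²) / 2 the terms E₄² E₆ cancel in D (E₄³ -
  -- E₆²), which leaves E₂ (E₄³ - E₆²); and E₂ = 1 - 24 S₁.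
  discriminant-log : D (qExp discriminant) ≈ (κ 1 A.- κ 24 ⊗ S 1) ⊗ qExp discriminant
  discriminant-log = A.trans (A.sym (∂-qExp discriminant))
    (identity (∂ discriminant) ((con 1 :- 24 ∙ s₁) :* discriminant) _ (S 1 ∷ S 3 ∷ S 5 ∷ []))

open Forms

-- The logarithmic derivative of τ

opaque
  unfolding ∑ Λ

  fromℤ-⊛ : ∀ f g → fromℤ ∘ (f ⊛ g) ≈ (fromℤ ∘ f) ⊗ (fromℤ ∘ g)
  fromℤ-⊛ f g n = trans (fromℤ-sum (suc n) (λ i → f (toℕ i) ℤ.* g (n ∸ toℕ i))) (∑ℚ.sum-cong-≗ {suc n} λ i → fromℤ-* (f (toℕ i)) (g (n ∸ toℕ i)))
    where
    fromℤ-sum : ∀ n (f : Fin n → ℤ) → fromℤ (∑ℤ.sum {n} f) ≡ ∑ℚ.sum {n} (fromℤ ∘ f)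
    fromℤ-sum zero    f = refl
    fromℤ-sum (suc n) f = trans (fromℤ-+ (f zero) (∑ℤ.sum {n} (f ∘ suc))) (cong (fromℤ (f zero) +_) (fromℤ-sum n (f ∘ suc)))

log-^ˢ : ∀ {f g} k → LogDerivative (fromℤ ∘ f) g → LogDerivative (fromℤ ∘ (f ^ˢ k)) (λ n → ↑ k * g n)
log-^ˢ {f} {g} zero    p = log-cong (A.sym mono-0) (λ n → sym (*-zeroˡ (g n))) log-one
log-^ˢ {f} {g} (suc k) p = log-cong (A.sym (fromℤ-⊛ f (f ^ˢ k))) multiple
  (log-⊗ {fromℤ ∘ f} {fromℤ ∘ (f ^ˢ k)} {g} {λ n → ↑ k * g n} p (log-^ˢ {f} {g} k p))
  where
  multiple : ∀ n → g n + ↑ k * g n ≡ ↑ suc k * g n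
  multiple n = trans (cong (_+ ↑ k * g n) (sym (*-identityˡ (g n))))
    (trans (sym (*-distribʳ-+ (g n) 1ℚ (↑ k))) (cong (_* g n) (sym (↑-+ 1 k))))

fromℤ-factor : ∀ i → fromℤ ∘ (one ⊖ q^ suc i) ≈ κ 1ℚ A.- mono (suc i)
fromℤ-factor i n = trans (fromℤ-+ (one n) (ℤ.- (q^ suc i) n))
  (cong₂ _+_ (mono-0 n) (fromℤ-neg ((q^ suc i) n)))

log-factor : ∀ i → LogDerivative (fromℤ ∘ (one ⊖ q^ suc i)) (A.- (κ (↑ suc i) ⊗ u (suc i)))
log-factor i = log-cong (A.sym (fromℤ-factor i)) (λ _ → refl) (log-1-mono i)

log-⊛-^ˢ : ∀ {F f g h} k → LogDerivative (fromℤ ∘ F) g → LogDerivative (fromℤ ∘ f) h →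
           LogDerivative (fromℤ ∘ (F ⊛ f ^ˢ k)) (g ⊕ (λ n → ↑ k * h n))
log-⊛-^ˢ {F} {f} {g} {h} k p q = log-cong (A.sym (fromℤ-⊛ F (f ^ˢ k))) (λ _ → refl)
  (log-⊗ {fromℤ ∘ F} {fromℤ ∘ (f ^ˢ k)} {g} {λ n → ↑ k * h n} p (log-^ˢ {f} {h} k q))

-- Stated separately because a conversion check that unfolds ^ˢ 24 takes exponential time
partialProduct-suc : ∀ N n → partialProduct (suc N) n ≡ (partialProduct N ⊛ (one ⊖ q^ suc N) ^ˢ 24) n
partialProduct-suc N n = refl

-- Each factor adds 24 times -x u_x. The power `^ℚ 1` gives the sum the shape it has in `S-∑ 1`.
log-partialProduct : ∀ N → LogDerivative (fromℤ ∘ partialProduct N)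
  (λ n → - (↑ 24 * ∑ N (λ i → ↑ suc i ^ℚ 1 * u (suc i) n)))
log-partialProduct zero    = log-cong (A.sym mono-0) (λ n → sym (cong (λ s → - (↑ 24 * s)) (∑-0 _))) log-one
log-partialProduct (suc N) = log-cong (λ n → cong fromℤ (sym (partialProduct-suc N n))) (accumulate (↑ 24))
  (log-⊛-^ˢ {partialProduct N} {one ⊖ q^ suc N} 24 (log-partialProduct N) (log-factor N))
  where
  open Rat
  distribute : ∀ a s x y → - (a * s) + a * - (x * y) ≡ - (a * (s + x * 1ℚ * y))
  distribute = solve 4 (λ a s x y → :- (a :* s) :+ a :* :- (x :* y) :=
    :- (a :* (s :+ x :* con 1ℚ :* y))) refl
  accumulate : ∀ a n → - (a * ∑ N (λ i → ↑ suc i ^ℚ 1 * u (suc i) n)) + a * - (κ (↑ suc N) ⊗ u (suc N)) n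
    ≡ - (a * ∑ (suc N) (λ i → ↑ suc i ^ℚ 1 * u (suc i) n))
  accumulate a n = begin
    - (a * s) + a * - (κ (↑ suc N) ⊗ u (suc N)) n    ≡⟨ cong (λ t → - (a * s) + a * - t) (κ-⊗ (↑ suc N) (u (suc N)) n) ⟩
    - (a * s) + a * - (↑ suc N * u (suc N) n)        ≡⟨ distribute a s (↑ suc N) (u (suc N) n) ⟩
    - (a * (s + ↑ suc N ^ℚ 1 * u (suc N) n))          ≡⟨ cong (λ t → - (a * t)) (∑-last N _) ⟨
    - (a * ∑ (suc N) (λ i → ↑ suc i ^ℚ 1 * u (suc i) n)) ∎
    where
    open ≡-Reasoning
    s = ∑ N (λ i → ↑ suc i ^ℚ 1 * u (suc i) n)

-- From the partial products to the infinite product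

infix 4 _≈[_]_
_≈[_]_ : (ℕ → ℚ) → ℕ → (ℕ → ℚ) → Set
f ≈[ N ] g = ∀ n → n ≤ N → f n ≡ g n

⊗-cong≤ : ∀ {N f f′ g g′} → f ≈[ N ] f′ → g ≈[ N ] g′ → f ⊗ g ≈[ N ] f′ ⊗ g′
⊗-cong≤ p q n n≤N = Λ-cong n λ { i j refl →
  cong₂ _*_ (p i (ℕ.≤-trans (ℕ.m≤m+n i j) n≤N)) (q j (ℕ.≤-trans (ℕ.m≤n+m j i) n≤N)) }

^ˢ-one : ∀ {N f} k → fromℤ ∘ f ≈[ N ] κ 1ℚ → fromℤ ∘ (f ^ˢ k) ≈[ N ] κ 1ℚ
^ˢ-one         zero    p n n≤N = mono-0 n
^ˢ-one {f = f} (suc k) p n n≤N = trans (fromℤ-⊛ f (f ^ˢ k) n)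
  (trans (⊗-cong≤ p (^ˢ-one k p) n n≤N) (A.*-identityˡ (κ 1ℚ) n))

factor-one : ∀ i → fromℤ ∘ (one ⊖ q^ suc i) ≈[ i ] κ 1ℚ
factor-one i n n≤i = trans (fromℤ-factor i n) (trans
  (cong (λ s → κ 1ℚ n - s) (trans (sym (A.*-identityʳ (mono (suc i)) n)) (mono-⊗-low (suc i) (κ 1ℚ) n (s≤s n≤i))))
  (+-identityʳ (κ 1ℚ n)))

⊛-^ˢ-stable : ∀ {N f} F k → fromℤ ∘ f ≈[ N ] κ 1ℚ → fromℤ ∘ (F ⊛ f ^ˢ k) ≈[ N ] fromℤ ∘ F
⊛-^ˢ-stable {f = f} F k p n n≤N = begin
  fromℤ ((F ⊛ f ^ˢ k) n)                  ≡⟨ fromℤ-⊛ F (f ^ˢ k) n ⟩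
  ((fromℤ ∘ F) ⊗ (fromℤ ∘ (f ^ˢ k))) n    ≡⟨ ⊗-cong≤ (λ _ _ → refl) (^ˢ-one k p) n n≤N ⟩
  ((fromℤ ∘ F) ⊗ κ 1ℚ) n                  ≡⟨ A.*-identityʳ (fromℤ ∘ F) n ⟩
  fromℤ (F n)                             ∎
  where open ≡-Reasoning

partialProduct-stable : ∀ d n → fromℤ (partialProduct (d ℕ.+ n) n) ≡ fromℤ (infiniteProduct n)
partialProduct-stable zero    n = refl
partialProduct-stable (suc d) n = begin
  fromℤ (partialProduct (suc N) n)                            ≡⟨ cong fromℤ (partialProduct-suc N n) ⟩
  fromℤ ((partialProduct N ⊛ (one ⊖ q^ suc N) ^ˢ 24) n)       ≡⟨ ⊛-^ˢ-stable {f = one ⊖ q^ suc N} (partialProduct N) 24 (factor-one N) n (ℕ.m≤n+m n d) ⟩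
  fromℤ (partialProduct N n)                                  ≡⟨ partialProduct-stable d n ⟩
  fromℤ (infiniteProduct n)                                   ∎
  where
  open ≡-Reasoning
  N = d ℕ.+ n

-- No single partial product serves all coefficients. At coefficient n = i + j the equation of the
-- n-th partial product is used: its sum up to n agrees with S₁ at i ≤ n, and its coefficient at j ≤
-- n is already the final one.
log-infiniteProduct : LogDerivative (fromℤ ∘ infiniteProduct) (λ n → - (↑ 24 * S 1 n))
D-log log-infiniteProduct n = trans (D-log (log-partialProduct n) n) (Λ-cong n λ { i j refl → cong₂ _*_
  (cong (λ s → - (↑ 24 * s)) (sym (S-∑ 1 (ℕ.m≤m+n i j)))) (partialProduct-stable i j) })

log-τ : LogDerivative (fromℤ ∘ τ) (κ 1ℚ A.- κ (↑ 24) ⊗ S 1)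
log-τ = log-cong (A.sym (fromℤ-⊛ (q^ 1) infiniteProduct))
  (λ n → cong (λ s → κ 1ℚ n - s) (sym (κ-⊗ (↑ 24) (S 1) n)))
  (log-⊗ {mono 1} {fromℤ ∘ infiniteProduct} {κ 1ℚ} {λ n → - (↑ 24 * S 1 n)} (mk (D-mono 1)) log-infiniteProduct)

-- The coefficient of qⁿ in D f = g f is n fₙ = g₀ fₙ + ⋯, which determines fₙ for n ≥ 2
log-unique : ∀ {f g} → LogDerivative f g → g 0 ≡ 1ℚ → f 0 ≡ 0ℚ → f 1 ≡ 0ℚ → ∀ n → f n ≡ 0ℚ
log-unique {f} {g} log g₀ f₀ f₁ = <-rec (λ n → f n ≡ 0ℚ) vanish
  where
  open ≡-Reasoning
  open Rat
  subtract : ∀ a x → (1ℚ + a) * x ≡ x → a * x ≡ 0ℚ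
  subtract a x eq = begin
    a * x               ≡⟨ expand a x ⟩
    (1ℚ + a) * x - x    ≡⟨ cong (_- x) eq ⟩
    x - x               ≡⟨ ℚ.+-inverseʳ x ⟩
    0ℚ                  ∎
    where
    expand : ∀ a x → a * x ≡ (1ℚ + a) * x - x
    expand = solve 2 (λ a x → a :* x := (con 1ℚ :+ a) :* x :- x) refl
  vanish : ∀ n → (∀ {m} → m < n → f m ≡ 0ℚ) → f n ≡ 0ℚ
  vanish zero          _  = f₀
  vanish (suc zero)    _  = f₁
  vanish n@(suc (suc m)) ih = begin
    f n                            ≡⟨ *-identityˡ (f n) ⟨
    1ℚ * f n                       ≡⟨ cong (_* f n) (ℚ.*-inverseˡ k) ⟨
    (1/ k * k) * f n               ≡⟨ *-assoc (1/ k) k (f n) ⟩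
    1/ k * (k * f n)               ≡⟨ cong (1/ k *_) (subtract k (f n) (trans (cong (_* f n) (sym (↑-+ 1 (suc m)))) recurrence)) ⟩
    1/ k * 0ℚ                      ≡⟨ *-zeroʳ (1/ k) ⟩
    0ℚ                             ∎
    where
    -- This is n - 1, which is invertible because n ≥ 2; the recurrence says (n - 1) fₙ = 0.
    k = ↑ suc m
    recurrence : ↑ n * f n ≡ f n
    recurrence = begin
      ↑ n * f n                                       ≡⟨ D-log log n ⟩
      (g ⊗ f) n                                       ≡⟨ Λ-suc (suc m) _ ⟩
      g 0 * f n + Λ (λ i j → g (suc i) * f j) (suc m) ≡⟨ cong₂ _+_ (trans (cong (_* f n) g₀) (*-identityˡ (f n)))
                                                          (Λ-zero (suc m) λ i j i+j≡ → trans (cong (g (suc i) *_)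
                                                            (ih (s≤s (ℕ.≤-trans (ℕ.m≤n+m j i) (ℕ.≤-reflexive i+j≡))))) (*-zeroʳ (g (suc i)))) ⟩
      f n + 0ℚ                                        ≡⟨ +-identityʳ (f n) ⟩
      f n                                             ∎

-- From polynomial identities to convolution sums

module ConvolutionSums where
  open Rat using (_:=_; _:+_; _:*_; _:-_; :-_; _:^_; con; solve)

  opaque
    unfolding ∑ Λ

    -- The product of series has two further terms, at m = 0 and m = n, which vanish together with
    -- the constant terms of `f` and `g`.
    ∑₁₋-⊗ : ∀ {n} f g → f 0 ≡ 0ℚ → g 0 ≡ 0ℚ → 1 ≤ n → sum₁₋ n (λ m → f m * g (n ∸ m)) ≡ (f ⊗ g) n
    ∑₁₋-⊗ {suc n} f g f₀ g₀ _ = begin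
      ∑ n h                                       ≡⟨ +-identityˡ (∑ n h) ⟨
      0ℚ + ∑ n h                                  ≡⟨ +-identityʳ (0ℚ + ∑ n h) ⟨
      0ℚ + ∑ n h + 0ℚ                             ≡⟨ cong₂ (λ a b → a + ∑ n h + b) first last ⟨
      f 0 * g (suc n) + ∑ n h + h n               ≡⟨ +-assoc (f 0 * g (suc n)) (∑ n h) (h n) ⟩
      f 0 * g (suc n) + (∑ n h + h n)             ≡⟨ cong (f 0 * g (suc n) +_) (∑-last n h) ⟨
      (f ⊗ g) (suc n)                             ∎
      where
      open ≡-Reasoning
      h : ℕ → ℚ
      h i = f (suc i) * g (n ∸ i)
      first : f 0 * g (suc n) ≡ 0ℚ
      first = trans (cong (_* g (suc n)) f₀) (*-zeroˡ (g (suc n)))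
      last : h n ≡ 0ℚ
      last = trans (cong (λ i → f (suc n) * g i) (ℕ.n∸n≡0 n)) (trans (cong (f (suc n) *_) g₀) (*-zeroʳ (f (suc n))))

    sum₁₋-cong : ∀ n {f g : ℕ → ℚ} → (∀ m → f m ≡ g m) → sum₁₋ n f ≡ sum₁₋ n g
    sum₁₋-cong n eq = ∑-cong (n ∸ 1) (λ i _ → eq (suc i))

  ⊗-linear : ∀ a f h g n → ((λ m → a * f m + h m) ⊗ g) n ≡ a * (f ⊗ g) n + (h ⊗ g) n
  ⊗-linear a f h g n = begin
    ((λ m → a * f m + h m) ⊗ g) n             ≡⟨ Λ-cong n (λ i j _ → distribute a (f i) (h i) (g j)) ⟩
    Λ (λ i j → a * (f i * g j) + h i * g j) n ≡⟨ Λ-+ n _ _ ⟩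
    Λ (λ i j → a * (f i * g j)) n + (h ⊗ g) n ≡⟨ cong (_+ (h ⊗ g) n) (Λ-*ˡ n a _) ⟨
    a * (f ⊗ g) n + (h ⊗ g) n                 ∎
    where
    open ≡-Reasoning
    distribute : ∀ a x y z → (a * x + y) * z ≡ a * (x * z) + y * z
    distribute = solve 4 (λ a x y z → (a :* x :+ y) :* z := a :* (x :* z) :+ y :* z) refl

  -- `moment j k n` is the sum of m^j σ₁(m) σ_k(n - m), because D multiplies the coefficient at m by
  -- m. The last clause stands for j = 3.
  moment : ℕ → ℕ → ℕ → ℚ
  moment 0 k = S 1 ⊗ S k
  moment 1 k = D (S 1) ⊗ S k
  moment 2 k = D (D (S 1)) ⊗ S k
  moment _ k = D (D (D (S 1))) ⊗ S k

  -- The coefficients of the cubic in m are constant in m but may depend on n, which covers weights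
  -- such as 9m - n or 36m² - 16mn + n².
  ∑₁₋-moments : ∀ k {n} a₀ a₁ a₂ a₃ {F : ℕ → ℚ} → 1 ≤ n →
    (∀ m → F m ≡ (a₀ + a₁ * ↑ m + a₂ * ↑ m ^ℚ 2 + a₃ * ↑ m ^ℚ 3) * ↑ σ 1 m * ↑ σ k (n ∸ m)) →
    sum₁₋ n F ≡ a₀ * moment 0 k n + (a₁ * moment 1 k n + (a₂ * moment 2 k n + a₃ * moment 3 k n))
  ∑₁₋-moments k {n} a₀ a₁ a₂ a₃ {F} 1≤n F≡ = begin
    sum₁₋ n F
      ≡⟨ sum₁₋-cong n (λ m → trans (F≡ m) (cong (_* ↑ σ k (n ∸ m)) (expand a₀ a₁ a₂ a₃ (↑ m) (S 1 m)))) ⟩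
    sum₁₋ n (λ m → f₀ m * S k (n ∸ m))
      -- `divisors 0` is the empty list, so the series S_k and all derivatives of S₁ have constant
      -- term 0.
      ≡⟨ ∑₁₋-⊗ f₀ (S k) (vanish a₀ a₁ a₂ a₃) refl 1≤n ⟩
    (f₀ ⊗ S k) n
      ≡⟨ ⊗-linear a₀ (S 1) f₁ (S k) n ⟩
    a₀ * moment 0 k n + (f₁ ⊗ S k) n
      ≡⟨ cong (a₀ * moment 0 k n +_) (⊗-linear a₁ (D (S 1)) f₂ (S k) n) ⟩
    a₀ * moment 0 k n + (a₁ * moment 1 k n + (f₂ ⊗ S k) n)
      ≡⟨ cong (λ s → a₀ * moment 0 k n + (a₁ * moment 1 k n + s)) (⊗-linear a₂ (D (D (S 1))) f₃ (S k) n) ⟩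
    a₀ * moment 0 k n + (a₁ * moment 1 k n + (a₂ * moment 2 k n + (f₃ ⊗ S k) n))
      ≡⟨ cong (λ s → a₀ * moment 0 k n + (a₁ * moment 1 k n + (a₂ * moment 2 k n + s))) scale ⟩
    a₀ * moment 0 k n + (a₁ * moment 1 k n + (a₂ * moment 2 k n + a₃ * moment 3 k n))  ∎
    where
    open ≡-Reasoning
    f₀ f₁ f₂ f₃ : ℕ → ℚ
    f₃ m = a₃ * D (D (D (S 1))) m
    f₂ m = a₂ * D (D (S 1)) m + f₃ m
    f₁ m = a₁ * D (S 1) m + f₂ m
    f₀ m = a₀ * S 1 m + f₁ m
    scale : (f₃ ⊗ S k) n ≡ a₃ * moment 3 k n
    scale = trans (Λ-cong n λ i j _ → *-assoc a₃ _ (S k j)) (sym (Λ-*ˡ n a₃ _))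
    vanish : ∀ a b c d → a * 0ℚ + (b * 0ℚ + (c * 0ℚ + d * 0ℚ)) ≡ 0ℚ
    vanish = solve 4 (λ a b c d → a :* con 0ℚ :+ (b :* con 0ℚ :+ (c :* con 0ℚ :+ d :* con 0ℚ)) := con 0ℚ) refl
    expand : ∀ a b c d m s → (a + b * m + c * m ^ℚ 2 + d * m ^ℚ 3) * s ≡
      a * s + (b * (m * s) + (c * (m * (m * s)) + d * (m * (m * (m * s)))))
    expand = solve 6 (λ a b c d m s → (a :+ b :* m :+ c :* m :^ 2 :+ d :* m :^ 3) :* s :=
      a :* s :+ (b :* (m :* s) :+ (c :* (m :* (m :* s)) :+ d :* (m :* (m :* (m :* s)))))) refl

  -- With variables for the constants of the theorem, each rearrangement is a ring identity

  reshape-i : ∀ a b c d z t k n → 1 ≤ n →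
    ⟪ a ⟨∙⟩ S₁ ⟨+⟩ (- (b * (d * z))) ⟨∙⟩ 𝐃 S₉ ⟨+⟩ c * (d * z) ⟨∙⟩ S₉ ⟨+⟩ t ⟨∙⟩ S₁₁ ⟨+⟩ (- k) ⟨∙⟩ (S₁ ⟨*⟩ S₉) ⟫ n ≡
    a * ↑ (σ 1 n) - (b * ↑ n - c) * d * z * ↑ (σ 9 n) + t * ↑ (σ 11 n) - k * (∑[1≤ m < n ] (↑ (σ 1 m) * ↑ (σ 9 (n ∸ m))))
  reshape-i a b c d z t k n 1≤n = total a b c d z t k (↑ n) (S 1 n) (S 9 n) (S 11 n)
      (moment 0 9 n) (moment 1 9 n) (moment 2 9 n) (moment 3 9 n)
      (∑₁₋-moments 9 1ℚ 0ℚ 0ℚ 0ℚ 1≤n λ m → summand (↑ m) (S 1 m) (S 9 (n ∸ m)))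
    where
    summand : ∀ m s t → s * t ≡
      (1ℚ + 0ℚ * m + 0ℚ * m ^ℚ 2 + 0ℚ * m ^ℚ 3) * s * t
    summand = solve 3 (λ m s t →
      s :* t :=
      (con 1ℚ :+ con 0ℚ :* m :+ con 0ℚ :* m :^ 2 :+ con 0ℚ :* m :^ 3) :* s :* t) refl
    total : ∀ a b c d z t k n s1 s9 s11 m0 m1 m2 m3 {z′} → z′ ≡ 1ℚ * m0 + (0ℚ * m1 + (0ℚ * m2 + 0ℚ * m3)) →
      a * s1 + (- (b * (d * z))) * (n * s9) + c * (d * z) * s9 + t * s11 + (- k) * m0 ≡
      a * s1 - (b * n - c) * d * z * s9 + t * s11 - k * z′
    total a b c d z t k n s1 s9 s11 m0 m1 m2 m3 refl = solve 15 (λ a b c d z t k n s1 s9 s11 m0 m1 m2 m3 →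
      a :* s1 :+ (:- (b :* (d :* z))) :* (n :* s9) :+ c :* (d :* z) :* s9 :+ t :* s11 :+ (:- k) :* m0 :=
      a :* s1 :- (b :* n :- c) :* d :* z :* s9 :+ t :* s11 :- k :* (con 1ℚ :* m0 :+ (con 0ℚ :* m1 :+ (con 0ℚ :* m2 :+ con 0ℚ :* m3)))) refl a b c d z t k n s1 s9 s11 m0 m1 m2 m3

  reshape-ii : ∀ a b c k n → 1 ≤ n →
    ⟪ a ⟨∙⟩ 𝐃 S₁ ⟨+⟩ (- b) ⟨∙⟩ 𝐃 S₉ ⟨+⟩ c ⟨∙⟩ 𝐃 (𝐃 S₇) ⟨+⟩ k ⟨∙⟩ (𝐃 S₁ ⟨*⟩ S₇) ⟫ n ≡
    a * ↑ n * ↑ (σ 1 n) - b * ↑ n * ↑ (σ 9 n) + c * ↑ (n ℕ.^ 2) * ↑ (σ 7 n) + k * (∑[1≤ m < n ] (↑ m * ↑ (σ 1 m) * ↑ (σ 7 (n ∸ m))))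
  reshape-ii a b c k n 1≤n = total a b c k (↑ n) (S 1 n) (S 7 n) (S 9 n)
      (moment 0 7 n) (moment 1 7 n) (moment 2 7 n) (moment 3 7 n) (↑-^ n 2)
      (∑₁₋-moments 7 0ℚ 1ℚ 0ℚ 0ℚ 1≤n λ m → summand (↑ m) (S 1 m) (S 7 (n ∸ m)))
    where
    summand : ∀ m s t → m * s * t ≡
      (0ℚ + 1ℚ * m + 0ℚ * m ^ℚ 2 + 0ℚ * m ^ℚ 3) * s * t
    summand = solve 3 (λ m s t →
      m :* s :* t :=
      (con 0ℚ :+ con 1ℚ :* m :+ con 0ℚ :* m :^ 2 :+ con 0ℚ :* m :^ 3) :* s :* t) refl
    total : ∀ a b c k n s1 s7 s9 m0 m1 m2 m3 {n2 z′} → n2 ≡ n ^ℚ 2 → z′ ≡ 0ℚ * m0 + (1ℚ * m1 + (0ℚ * m2 + 0ℚ * m3)) →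
      a * (n * s1) + (- b) * (n * s9) + c * (n * (n * s7)) + k * m1 ≡
      a * n * s1 - b * n * s9 + c * n2 * s7 + k * z′
    total a b c k n s1 s7 s9 m0 m1 m2 m3 refl refl = solve 12 (λ a b c k n s1 s7 s9 m0 m1 m2 m3 →
      a :* (n :* s1) :+ (:- b) :* (n :* s9) :+ c :* (n :* (n :* s7)) :+ k :* m1 :=
      a :* n :* s1 :- b :* n :* s9 :+ c :* n :^ 2 :* s7 :+ k :* (con 0ℚ :* m0 :+ (con 1ℚ :* m1 :+ (con 0ℚ :* m2 :+ con 0ℚ :* m3)))) refl a b c k n s1 s7 s9 m0 m1 m2 m3

  reshape-iii : ∀ a b c k n → 1 ≤ n →
    ⟪ a ⟨∙⟩ 𝐃 (𝐃 S₁) ⟨+⟩ (- b) ⟨∙⟩ 𝐃 (𝐃 (𝐃 S₅)) ⟨+⟩ c ⟨∙⟩ 𝐃 (𝐃 S₇) ⟨+⟩ (- k) ⟨∙⟩ (𝐃 (𝐃 S₁) ⟨*⟩ S₅) ⟫ n ≡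
    a * ↑ (n ℕ.^ 2) * ↑ (σ 1 n) - b * ↑ (n ℕ.^ 3) * ↑ (σ 5 n) + c * ↑ (n ℕ.^ 2) * ↑ (σ 7 n) - k * (∑[1≤ m < n ] (↑ (m ℕ.^ 2) * ↑ (σ 1 m) * ↑ (σ 5 (n ∸ m))))
  reshape-iii a b c k n 1≤n = total a b c k (↑ n) (S 1 n) (S 5 n) (S 7 n)
      (moment 0 5 n) (moment 1 5 n) (moment 2 5 n) (moment 3 5 n) (↑-^ n 2) (↑-^ n 3)
      (∑₁₋-moments 5 0ℚ 0ℚ 1ℚ 0ℚ 1≤n λ m → summand (↑ m) (S 1 m) (S 5 (n ∸ m)) (↑-^ m 2))
    where
    summand : ∀ m s t {m2} → m2 ≡ m ^ℚ 2 → m2 * s * t ≡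
      (0ℚ + 0ℚ * m + 1ℚ * m ^ℚ 2 + 0ℚ * m ^ℚ 3) * s * t
    summand m s t refl = solve 3 (λ m s t →
      m :^ 2 :* s :* t :=
      (con 0ℚ :+ con 0ℚ :* m :+ con 1ℚ :* m :^ 2 :+ con 0ℚ :* m :^ 3) :* s :* t) refl m s t
    total : ∀ a b c k n s1 s5 s7 m0 m1 m2 m3 {n2 n3 z′} → n2 ≡ n ^ℚ 2 → n3 ≡ n ^ℚ 3 → z′ ≡ 0ℚ * m0 + (0ℚ * m1 + (1ℚ * m2 + 0ℚ * m3)) →
      a * (n * (n * s1)) + (- b) * (n * (n * (n * s5))) + c * (n * (n * s7)) + (- k) * m2 ≡
      a * n2 * s1 - b * n3 * s5 + c * n2 * s7 - k * z′
    total a b c k n s1 s5 s7 m0 m1 m2 m3 refl refl refl = solve 12 (λ a b c k n s1 s5 s7 m0 m1 m2 m3 →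
      a :* (n :* (n :* s1)) :+ (:- b) :* (n :* (n :* (n :* s5))) :+ c :* (n :* (n :* s7)) :+ (:- k) :* m2 :=
      a :* n :^ 2 :* s1 :- b :* n :^ 3 :* s5 :+ c :* n :^ 2 :* s7 :- k :* (con 0ℚ :* m0 :+ (con 0ℚ :* m1 :+ (con 1ℚ :* m2 :+ con 0ℚ :* m3)))) refl a b c k n s1 s5 s7 m0 m1 m2 m3

  reshape-iv : ∀ a b c k n → 1 ≤ n →
    ⟪ a ⟨∙⟩ 𝐃 (𝐃 (𝐃 S₁)) ⟨+⟩ b ⟨∙⟩ 𝐃 (𝐃 (𝐃 (𝐃 S₃))) ⟨+⟩ (- c) ⟨∙⟩ 𝐃 (𝐃 (𝐃 S₅)) ⟨+⟩ k ⟨∙⟩ (𝐃 (𝐃 (𝐃 S₁)) ⟨*⟩ S₃) ⟫ n ≡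
    a * ↑ (n ℕ.^ 3) * ↑ (σ 1 n) + b * ↑ (n ℕ.^ 4) * ↑ (σ 3 n) - c * ↑ (n ℕ.^ 3) * ↑ (σ 5 n) + k * (∑[1≤ m < n ] (↑ (m ℕ.^ 3) * ↑ (σ 1 m) * ↑ (σ 3 (n ∸ m))))
  reshape-iv a b c k n 1≤n = total a b c k (↑ n) (S 1 n) (S 3 n) (S 5 n)
      (moment 0 3 n) (moment 1 3 n) (moment 2 3 n) (moment 3 3 n) (↑-^ n 3) (↑-^ n 4)
      (∑₁₋-moments 3 0ℚ 0ℚ 0ℚ 1ℚ 1≤n λ m → summand (↑ m) (S 1 m) (S 3 (n ∸ m)) (↑-^ m 3))
    where
    summand : ∀ m s t {m3} → m3 ≡ m ^ℚ 3 → m3 * s * t ≡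
      (0ℚ + 0ℚ * m + 0ℚ * m ^ℚ 2 + 1ℚ * m ^ℚ 3) * s * t
    summand m s t refl = solve 3 (λ m s t →
      m :^ 3 :* s :* t :=
      (con 0ℚ :+ con 0ℚ :* m :+ con 0ℚ :* m :^ 2 :+ con 1ℚ :* m :^ 3) :* s :* t) refl m s t
    total : ∀ a b c k n s1 s3 s5 m0 m1 m2 m3 {n3 n4 z′} → n3 ≡ n ^ℚ 3 → n4 ≡ n ^ℚ 4 → z′ ≡ 0ℚ * m0 + (0ℚ * m1 + (0ℚ * m2 + 1ℚ * m3)) →
      a * (n * (n * (n * s1))) + b * (n * (n * (n * (n * s3)))) + (- c) * (n * (n * (n * s5))) + k * m3 ≡
      a * n3 * s1 + b * n4 * s3 - c * n3 * s5 + k * z′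
    total a b c k n s1 s3 s5 m0 m1 m2 m3 refl refl refl = solve 12 (λ a b c k n s1 s3 s5 m0 m1 m2 m3 →
      a :* (n :* (n :* (n :* s1))) :+ b :* (n :* (n :* (n :* (n :* s3)))) :+ (:- c) :* (n :* (n :* (n :* s5))) :+ k :* m3 :=
      a :* n :^ 3 :* s1 :+ b :* n :^ 4 :* s3 :- c :* n :^ 3 :* s5 :+ k :* (con 0ℚ :* m0 :+ (con 0ℚ :* m1 :+ (con 0ℚ :* m2 :+ con 1ℚ :* m3)))) refl a b c k n s1 s3 s5 m0 m1 m2 m3

  -- A factor m differentiates the first series only, whereas a factor n differentiates the whole
  -- product. So the weight p m - n turns into p (D S₁) S₇ - D (S₁ S₇), and the mixed weights in the
  -- following lemmas are treated alike.
  reshape-v : ∀ a b c k p n → 1 ≤ n →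
    ⟪ a ⟨∙⟩ 𝐃 S₁ ⟨+⟩ b ⟨∙⟩ 𝐃 S₇ ⟨+⟩ (- c) ⟨∙⟩ 𝐃 S₉ ⟨+⟩ k ⟨∙⟩ (p ⟨∙⟩ (𝐃 S₁ ⟨*⟩ S₇) ⟨+⟩ (- 1ℚ) ⟨∙⟩ 𝐃 (S₁ ⟨*⟩ S₇)) ⟫ n ≡
    a * ↑ n * ↑ (σ 1 n) + b * ↑ n * ↑ (σ 7 n) - c * ↑ n * ↑ (σ 9 n) + k * (∑[1≤ m < n ] ((p * ↑ m - ↑ n) * ↑ (σ 1 m) * ↑ (σ 7 (n ∸ m))))
  reshape-v a b c k p n 1≤n = total a b c k p (↑ n) (S 1 n) (S 7 n) (S 9 n)
      (moment 0 7 n) (moment 1 7 n) (moment 2 7 n) (moment 3 7 n)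
      (∑₁₋-moments 7 (- ↑ n) p 0ℚ 0ℚ 1≤n λ m → summand p (↑ n) (↑ m) (S 1 m) (S 7 (n ∸ m)))
    where
    summand : ∀ p n m s t → (p * m - n) * s * t ≡
      ((- n) + p * m + 0ℚ * m ^ℚ 2 + 0ℚ * m ^ℚ 3) * s * t
    summand = solve 5 (λ p n m s t →
      (p :* m :- n) :* s :* t :=
      ((:- n) :+ p :* m :+ con 0ℚ :* m :^ 2 :+ con 0ℚ :* m :^ 3) :* s :* t) refl
    total : ∀ a b c k p n s1 s7 s9 m0 m1 m2 m3 {z′} → z′ ≡ (- n) * m0 + (p * m1 + (0ℚ * m2 + 0ℚ * m3)) →
      a * (n * s1) + b * (n * s7) + (- c) * (n * s9) + k * (p * m1 + (- 1ℚ) * (n * m0)) ≡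
      a * n * s1 + b * n * s7 - c * n * s9 + k * z′
    total a b c k p n s1 s7 s9 m0 m1 m2 m3 refl = solve 13 (λ a b c k p n s1 s7 s9 m0 m1 m2 m3 →
      a :* (n :* s1) :+ b :* (n :* s7) :+ (:- c) :* (n :* s9) :+ k :* (p :* m1 :+ (:- con 1ℚ) :* (n :* m0)) :=
      a :* n :* s1 :+ b :* n :* s7 :- c :* n :* s9 :+ k :* ((:- n) :* m0 :+ (p :* m1 :+ (con 0ℚ :* m2 :+ con 0ℚ :* m3)))) refl a b c k p n s1 s7 s9 m0 m1 m2 m3

  reshape-vi : ∀ a b k p n → 1 ≤ n →
    ⟪ a ⟨∙⟩ 𝐃 (𝐃 S₁) ⟨+⟩ b ⟨∙⟩ 𝐃 (𝐃 S₇) ⟨+⟩ (- k) ⟨∙⟩ (p ⟨∙⟩ (𝐃 (𝐃 S₁) ⟨*⟩ S₅) ⟨+⟩ (- 1ℚ) ⟨∙⟩ 𝐃 (𝐃 S₁ ⟨*⟩ S₅)) ⟫ n ≡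
    a * ↑ (n ℕ.^ 2) * ↑ (σ 1 n) + b * ↑ (n ℕ.^ 2) * ↑ (σ 7 n) - k * (∑[1≤ m < n ] ((p * ↑ (m ℕ.^ 2) - ↑ m * ↑ n) * ↑ (σ 1 m) * ↑ (σ 5 (n ∸ m))))
  reshape-vi a b k p n 1≤n = total a b k p (↑ n) (S 1 n) (S 7 n)
      (moment 0 5 n) (moment 1 5 n) (moment 2 5 n) (moment 3 5 n) (↑-^ n 2)
      (∑₁₋-moments 5 0ℚ (- ↑ n) p 0ℚ 1≤n λ m → summand p (↑ n) (↑ m) (S 1 m) (S 5 (n ∸ m)) (↑-^ m 2))
    where
    summand : ∀ p n m s t {m2} → m2 ≡ m ^ℚ 2 → (p * m2 - m * n) * s * t ≡
      (0ℚ + (- n) * m + p * m ^ℚ 2 + 0ℚ * m ^ℚ 3) * s * t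
    summand p n m s t refl = solve 5 (λ p n m s t →
      (p :* m :^ 2 :- m :* n) :* s :* t :=
      (con 0ℚ :+ (:- n) :* m :+ p :* m :^ 2 :+ con 0ℚ :* m :^ 3) :* s :* t) refl p n m s t
    total : ∀ a b k p n s1 s7 m0 m1 m2 m3 {n2 z′} → n2 ≡ n ^ℚ 2 → z′ ≡ 0ℚ * m0 + ((- n) * m1 + (p * m2 + 0ℚ * m3)) →
      a * (n * (n * s1)) + b * (n * (n * s7)) + (- k) * (p * m2 + (- 1ℚ) * (n * m1)) ≡
      a * n2 * s1 + b * n2 * s7 - k * z′
    total a b k p n s1 s7 m0 m1 m2 m3 refl refl = solve 11 (λ a b k p n s1 s7 m0 m1 m2 m3 →
      a :* (n :* (n :* s1)) :+ b :* (n :* (n :* s7)) :+ (:- k) :* (p :* m2 :+ (:- con 1ℚ) :* (n :* m1)) :=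
      a :* n :^ 2 :* s1 :+ b :* n :^ 2 :* s7 :- k :* (con 0ℚ :* m0 :+ ((:- n) :* m1 :+ (p :* m2 :+ con 0ℚ :* m3)))) refl a b k p n s1 s7 m0 m1 m2 m3

  reshape-vii : ∀ a b k p q n → 1 ≤ n →
    ⟪ a ⟨∙⟩ 𝐃 (𝐃 (𝐃 S₁)) ⟨+⟩ (- b) ⟨∙⟩ 𝐃 (𝐃 (𝐃 S₅)) ⟨+⟩ k ⟨∙⟩ (p ⟨∙⟩ (𝐃 (𝐃 (𝐃 S₁)) ⟨*⟩ S₃) ⟨+⟩ (- q) ⟨∙⟩ 𝐃 (𝐃 (𝐃 S₁) ⟨*⟩ S₃)) ⟫ n ≡
    a * ↑ (n ℕ.^ 3) * ↑ (σ 1 n) - b * ↑ (n ℕ.^ 3) * ↑ (σ 5 n) + k * (∑[1≤ m < n ] ((p * ↑ (m ℕ.^ 3) - q * ↑ (m ℕ.^ 2) * ↑ n) * ↑ (σ 1 m) * ↑ (σ 3 (n ∸ m))))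
  reshape-vii a b k p q n 1≤n = total a b k p q (↑ n) (S 1 n) (S 5 n)
      (moment 0 3 n) (moment 1 3 n) (moment 2 3 n) (moment 3 3 n) (↑-^ n 3)
      (∑₁₋-moments 3 0ℚ 0ℚ (- (q * ↑ n)) p 1≤n λ m → summand p q (↑ n) (↑ m) (S 1 m) (S 3 (n ∸ m)) (↑-^ m 2) (↑-^ m 3))
    where
    summand : ∀ p q n m s t {m2 m3} → m2 ≡ m ^ℚ 2 → m3 ≡ m ^ℚ 3 → (p * m3 - q * m2 * n) * s * t ≡
      (0ℚ + 0ℚ * m + (- (q * n)) * m ^ℚ 2 + p * m ^ℚ 3) * s * t
    summand p q n m s t refl refl = solve 6 (λ p q n m s t →
      (p :* m :^ 3 :- q :* m :^ 2 :* n) :* s :* t :=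
      (con 0ℚ :+ con 0ℚ :* m :+ (:- (q :* n)) :* m :^ 2 :+ p :* m :^ 3) :* s :* t) refl p q n m s t
    total : ∀ a b k p q n s1 s5 m0 m1 m2 m3 {n3 z′} → n3 ≡ n ^ℚ 3 → z′ ≡ 0ℚ * m0 + (0ℚ * m1 + ((- (q * n)) * m2 + p * m3)) →
      a * (n * (n * (n * s1))) + (- b) * (n * (n * (n * s5))) + k * (p * m3 + (- q) * (n * m2)) ≡
      a * n3 * s1 - b * n3 * s5 + k * z′
    total a b k p q n s1 s5 m0 m1 m2 m3 refl refl = solve 12 (λ a b k p q n s1 s5 m0 m1 m2 m3 →
      a :* (n :* (n :* (n :* s1))) :+ (:- b) :* (n :* (n :* (n :* s5))) :+ k :* (p :* m3 :+ (:- q) :* (n :* m2)) :=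
      a :* n :^ 3 :* s1 :- b :* n :^ 3 :* s5 :+ k :* (con 0ℚ :* m0 :+ (con 0ℚ :* m1 :+ ((:- (q :* n)) :* m2 :+ p :* m3)))) refl a b k p q n s1 s5 m0 m1 m2 m3

  reshape-viii : ∀ a b k p q n → 1 ≤ n →
    ⟪ a ⟨∙⟩ 𝐃 (𝐃 S₁) ⟨+⟩ b ⟨∙⟩ 𝐃 (𝐃 S₅) ⟨+⟩ (- k) ⟨∙⟩ (p ⟨∙⟩ (𝐃 (𝐃 S₁) ⟨*⟩ S₅) ⟨+⟩ (- q) ⟨∙⟩ 𝐃 (𝐃 S₁ ⟨*⟩ S₅) ⟨+⟩ 𝐃 (𝐃 (S₁ ⟨*⟩ S₅))) ⟫ n ≡
    a * ↑ (n ℕ.^ 2) * ↑ (σ 1 n) + b * ↑ (n ℕ.^ 2) * ↑ (σ 5 n) - k * (∑[1≤ m < n ] ((p * ↑ (m ℕ.^ 2) - q * ↑ m * ↑ n + ↑ (n ℕ.^ 2)) * ↑ (σ 1 m) * ↑ (σ 5 (n ∸ m))))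
  reshape-viii a b k p q n 1≤n = total a b k p q (↑ n) (S 1 n) (S 5 n)
      (moment 0 5 n) (moment 1 5 n) (moment 2 5 n) (moment 3 5 n) (↑-^ n 2)
      (∑₁₋-moments 5 (↑ n ^ℚ 2) (- (q * ↑ n)) p 0ℚ 1≤n λ m → summand p q (↑ n) (↑ m) (S 1 m) (S 5 (n ∸ m)) (↑-^ m 2) (↑-^ n 2))
    where
    summand : ∀ p q n m s t {m2 n2} → m2 ≡ m ^ℚ 2 → n2 ≡ n ^ℚ 2 → (p * m2 - q * m * n + n2) * s * t ≡
      ((n ^ℚ 2) + (- (q * n)) * m + p * m ^ℚ 2 + 0ℚ * m ^ℚ 3) * s * t
    summand p q n m s t refl refl = solve 6 (λ p q n m s t →
      (p :* m :^ 2 :- q :* m :* n :+ n :^ 2) :* s :* t :=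
      ((n :^ 2) :+ (:- (q :* n)) :* m :+ p :* m :^ 2 :+ con 0ℚ :* m :^ 3) :* s :* t) refl p q n m s t
    total : ∀ a b k p q n s1 s5 m0 m1 m2 m3 {n2 z′} → n2 ≡ n ^ℚ 2 → z′ ≡ (n ^ℚ 2) * m0 + ((- (q * n)) * m1 + (p * m2 + 0ℚ * m3)) →
      a * (n * (n * s1)) + b * (n * (n * s5)) + (- k) * (p * m2 + (- q) * (n * m1) + n * (n * m0)) ≡
      a * n2 * s1 + b * n2 * s5 - k * z′
    total a b k p q n s1 s5 m0 m1 m2 m3 refl refl = solve 12 (λ a b k p q n s1 s5 m0 m1 m2 m3 →
      a :* (n :* (n :* s1)) :+ b :* (n :* (n :* s5)) :+ (:- k) :* (p :* m2 :+ (:- q) :* (n :* m1) :+ n :* (n :* m0)) :=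
      a :* n :^ 2 :* s1 :+ b :* n :^ 2 :* s5 :- k :* ((n :^ 2) :* m0 :+ ((:- (q :* n)) :* m1 :+ (p :* m2 :+ con 0ℚ :* m3)))) refl a b k p q n s1 s5 m0 m1 m2 m3

  reshape-ix : ∀ k p q r n → 1 ≤ n →
    ⟪ 𝐃 (𝐃 (𝐃 S₁)) ⟨+⟩ (- k) ⟨∙⟩ (p ⟨∙⟩ 𝐃 (𝐃 (𝐃 S₁) ⟨*⟩ S₃) ⟨+⟩ (- q) ⟨∙⟩ (𝐃 (𝐃 (𝐃 S₁)) ⟨*⟩ S₃) ⟨+⟩ (- r) ⟨∙⟩ 𝐃 (𝐃 (𝐃 S₁ ⟨*⟩ S₃))) ⟫ n ≡
    ↑ (n ℕ.^ 3) * ↑ (σ 1 n) - k * (∑[1≤ m < n ] ((p * ↑ (m ℕ.^ 2) * ↑ n - q * ↑ (m ℕ.^ 3) - r * ↑ m * ↑ (n ℕ.^ 2)) * ↑ (σ 1 m) * ↑ (σ 3 (n ∸ m))))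
  reshape-ix k p q r n 1≤n = total k p q r (↑ n) (S 1 n)
      (moment 0 3 n) (moment 1 3 n) (moment 2 3 n) (moment 3 3 n) (↑-^ n 3)
      (∑₁₋-moments 3 0ℚ (- (r * ↑ n ^ℚ 2)) (p * ↑ n) (- q) 1≤n λ m → summand p q r (↑ n) (↑ m) (S 1 m) (S 3 (n ∸ m)) (↑-^ m 2) (↑-^ m 3) (↑-^ n 2))
    where
    summand : ∀ p q r n m s t {m2 m3 n2} → m2 ≡ m ^ℚ 2 → m3 ≡ m ^ℚ 3 → n2 ≡ n ^ℚ 2 → (p * m2 * n - q * m3 - r * m * n2) * s * t ≡
      (0ℚ + (- (r * n ^ℚ 2)) * m + (p * n) * m ^ℚ 2 + (- q) * m ^ℚ 3) * s * t
    summand p q r n m s t refl refl refl = solve 7 (λ p q r n m s t →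
      (p :* m :^ 2 :* n :- q :* m :^ 3 :- r :* m :* n :^ 2) :* s :* t :=
      (con 0ℚ :+ (:- (r :* n :^ 2)) :* m :+ (p :* n) :* m :^ 2 :+ (:- q) :* m :^ 3) :* s :* t) refl p q r n m s t
    total : ∀ k p q r n s1 m0 m1 m2 m3 {n3 z′} → n3 ≡ n ^ℚ 3 → z′ ≡ 0ℚ * m0 + ((- (r * n ^ℚ 2)) * m1 + ((p * n) * m2 + (- q) * m3)) →
      n * (n * (n * s1)) + (- k) * (p * (n * m2) + (- q) * m3 + (- r) * (n * (n * m1))) ≡
      n3 * s1 - k * z′
    total k p q r n s1 m0 m1 m2 m3 refl refl = solve 10 (λ k p q r n s1 m0 m1 m2 m3 →
      n :* (n :* (n :* s1)) :+ (:- k) :* (p :* (n :* m2) :+ (:- q) :* m3 :+ (:- r) :* (n :* (n :* m1))) :=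
      n :^ 3 :* s1 :- k :* (con 0ℚ :* m0 :+ ((:- (r :* n :^ 2)) :* m1 :+ ((p :* n) :* m2 :+ (:- q) :* m3)))) refl k p q r n s1 m0 m1 m2 m3

open ConvolutionSums

open import Agda.Builtin.FromNat using (fromNat)
open import Data.Unit using (tt)

opaque
  unfolding ∑ Λ

  discriminant-0 : qExp discriminant 0 ≡ 0
  discriminant-0 = refl

  -- The linear terms give (3 · 240 + 2 · 504) / 1728 = 1, which is where the denominator comes
  -- from.
  discriminant-1 : qExp discriminant 1 ≡ 1
  discriminant-1 = refl

-- The equation D f = (1 - 24 S₁) f is linear, so the difference of the two solutions solves it too.
-- Its coefficients at 0 and 1 vanish, and `log-unique` forces the rest to vanish.
τ-discriminant : fromℤ ∘ τ ≈ qExp discriminant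
τ-discriminant n = x-y≡0⇒x≡y (fromℤ (τ n)) (qExp discriminant n) (log-unique {δ} {g} log-δ (cong (λ s → 1 - s) (κ-⊗ 24 (S 1) 0))
  (cong (λ s → fromℤ (τ 0) - s) discriminant-0) (cong (λ s → fromℤ (τ 1) - s) discriminant-1) n)
  where
  open import Algebra.Properties.Group ℚ.+-0-group renaming (x∙y⁻¹≈ε⇒x≈y to x-y≡0⇒x≡y)
  δ g : ℕ → ℚ
  δ = (fromℤ ∘ τ) A.- qExp discriminant
  g = κ 1 A.- κ 24 ⊗ S 1
  log-δ : LogDerivative δ g
  log-δ = mk (A.trans (D-⊕ (fromℤ ∘ τ) (A.- qExp discriminant)) (A.trans
    (A.+-cong (LogDerivative.D-log log-τ) (A.trans (D-neg (qExp discriminant)) (A.-‿cong discriminant-log)))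
    (A.sym (distrib g (fromℤ ∘ τ) (qExp discriminant)))))
    where
    distrib : ∀ f g h → f ⊗ (g A.- h) ≈ f ⊗ g A.- f ⊗ h
    distrib f g h = A.trans (A.distribˡ f g (A.- h)) (A.+-congˡ {f ⊗ g} (A.sym (-‿distribʳ-* f h)))
      where open import Algebra.Properties.Ring A.ring using (-‿distribʳ-*)

-- The implicit check compares the normal form of `form e` with that of (E₄³ - E₆²) / 1728. It
-- carries the whole arithmetic of an identity; what remains is to read the coefficient of `e` as
-- the stated right-hand side.
τ-expression : ∀ e n {x} → {T (discriminant Ser.≟ᴺ form e)} → ⟪ e ⟫ n ≡ x → fromℤ (τ n) ≡ x
τ-expression e n {_} {check} eq = begin
  fromℤ (τ n)              ≡⟨ τ-discriminant n ⟩
  qExp discriminant n    ≡⟨ Ser.identity discriminant (form e) check (S 1 ∷ S 3 ∷ S 5 ∷ []) n ⟩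
  qExp (form e) n        ≡⟨ form-correct e n ⟨
  ⟪ e ⟫ n                  ≡⟨ eq ⟩
  _                        ∎
  where
  open ≡-Reasoning

theorem2p7 : (n : ℕ) → 1 ≤ n →
    (fromℤ (τ n) ≡ (5 * 691) ÷ 9504 * ↑ (σ 1 n) - ((6 * ↑ n - 5) * 691) ÷ 864 * ↑ (σ 9 n) + 2275 ÷ 1584 * ↑ (σ 11 n)
    - (5 * 691) ÷ 36 * (∑[1≤ m < n ] (↑ (σ 1 m) * ↑ (σ 9 (n ∸ m)))))
    ×
    (fromℤ (τ n) ≡ 15 ÷ 32 * ↑ n * ↑ (σ 1 n) - 33 ÷ 32 * ↑ n * ↑ (σ 9 n) + 50 ÷ 32 * ↑ (n ^ 2) * ↑ (σ 7 n)
    + 225 * (∑[1≤ m < n ] (↑ m * ↑ (σ 1 m) * ↑ (σ 7 (n ∸ m)))))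
    ×
    (fromℤ (τ n) ≡ 6 ÷ 7 * ↑ (n ^ 2) * ↑ (σ 1 n) - 9 ÷ 7 * ↑ (n ^ 3) * ↑ (σ 5 n) + 10 ÷ 7 * ↑ (n ^ 2) * ↑ (σ 7 n)
    - 24 * 18 * (∑[1≤ m < n ] (↑ (m ^ 2) * ↑ (σ 1 m) * ↑ (σ 5 (n ∸ m)))))
    ×
    (fromℤ (τ n) ≡ 14 ÷ 5 * ↑ (n ^ 3) * ↑ (σ 1 n) + 12 ÷ 5 * ↑ (n ^ 4) * ↑ (σ 3 n) - 21 ÷ 5 * ↑ (n ^ 3) * ↑ (σ 5 n)
    + 24 * 28 * (∑[1≤ m < n ] (↑ (m ^ 3) * ↑ (σ 1 m) * ↑ (σ 3 (n ∸ m)))))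
    ×
    (fromℤ (τ n) ≡ 5 ÷ 12 * ↑ n * ↑ (σ 1 n) + 25 ÷ 24 * ↑ n * ↑ (σ 7 n) - 11 ÷ 24 * ↑ n * ↑ (σ 9 n)
    + 25 * (∑[1≤ m < n ] ((9 * ↑ m - ↑ n) * ↑ (σ 1 m) * ↑ (σ 7 (n ∸ m)))))
    ×
    (fromℤ (τ n) ≡ 9 ÷ 14 * ↑ (n ^ 2) * ↑ (σ 1 n) + 5 ÷ 14 * ↑ (n ^ 2) * ↑ (σ 7 n)
    - 108 * (∑[1≤ m < n ] ((4 * ↑ (m ^ 2) - ↑ m * ↑ n) * ↑ (σ 1 m) * ↑ (σ 5 (n ∸ m)))))
    ×
    (fromℤ (τ n) ≡ 8 ÷ 5 * ↑ (n ^ 3) * ↑ (σ 1 n) - 3 ÷ 5 * ↑ (n ^ 3) * ↑ (σ 5 n)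
    + 96 * (∑[1≤ m < n ] ((7 * ↑ (m ^ 3) - 3 * ↑ (m ^ 2) * ↑ n) * ↑ (σ 1 m) * ↑ (σ 3 (n ∸ m)))))
    ×
    (fromℤ (τ n) ≡ 1 ÷ 2 * ↑ (n ^ 2) * ↑ (σ 1 n) + 1 ÷ 2 * ↑ (n ^ 2) * ↑ (σ 5 n)
    - 12 * (∑[1≤ m < n ] ((36 * ↑ (m ^ 2) - 16 * ↑ m * ↑ n + ↑ (n ^ 2)) * ↑ (σ 1 m) * ↑ (σ 5 (n ∸ m)))))
    ×
    (fromℤ (τ n) ≡ ↑ (n ^ 3) * ↑ (σ 1 n)
    - 24 * (∑[1≤ m < n ] ((21 * ↑ (m ^ 2) * ↑ n - 28 * ↑ (m ^ 3) - 3 * ↑ m * ↑ (n ^ 2)) * ↑ (σ 1 m) * ↑ (σ 3 (n ∸ m)))))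
theorem2p7 n 1≤n =
    -- The coefficient of σ₉ involves n, so it is split into a multiple of D S₉ and one of S₉. The
    -- quotient unfolds to a product with `1/ 864`, which is therefore passed on as a constant of
    -- its own.
    τ-expression (((5 * 691) ÷ 9504) ⟨∙⟩ S₁ ⟨+⟩ (- (6 * (691 * (1/ 864)))) ⟨∙⟩ 𝐃 S₉ ⟨+⟩ 5 * (691 * (1/ 864)) ⟨∙⟩ S₉ ⟨+⟩ (2275 ÷ 1584) ⟨∙⟩ S₁₁ ⟨+⟩ (- ((5 * 691) ÷ 36)) ⟨∙⟩ (S₁ ⟨*⟩ S₉))
    n (reshape-i ((5 * 691) ÷ 9504) 6 5 691 (1/ 864) (2275 ÷ 1584) ((5 * 691) ÷ 36) n 1≤n)
  , τ-expression ((15 ÷ 32) ⟨∙⟩ 𝐃 S₁ ⟨+⟩ (- (33 ÷ 32)) ⟨∙⟩ 𝐃 S₉ ⟨+⟩ (50 ÷ 32) ⟨∙⟩ 𝐃 (𝐃 S₇) ⟨+⟩ 225 ⟨∙⟩ (𝐃 S₁ ⟨*⟩ S₇))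
    n (reshape-ii (15 ÷ 32) (33 ÷ 32) (50 ÷ 32) 225 n 1≤n)
  , τ-expression ((6 ÷ 7) ⟨∙⟩ 𝐃 (𝐃 S₁) ⟨+⟩ (- (9 ÷ 7)) ⟨∙⟩ 𝐃 (𝐃 (𝐃 S₅)) ⟨+⟩ (10 ÷ 7) ⟨∙⟩ 𝐃 (𝐃 S₇) ⟨+⟩ (- (24 * 18)) ⟨∙⟩ (𝐃 (𝐃 S₁) ⟨*⟩ S₅))
    n (reshape-iii (6 ÷ 7) (9 ÷ 7) (10 ÷ 7) (24 * 18) n 1≤n)
  , τ-expression ((14 ÷ 5) ⟨∙⟩ 𝐃 (𝐃 (𝐃 S₁)) ⟨+⟩ (12 ÷ 5) ⟨∙⟩ 𝐃 (𝐃 (𝐃 (𝐃 S₃))) ⟨+⟩ (- (21 ÷ 5)) ⟨∙⟩ 𝐃 (𝐃 (𝐃 S₅)) ⟨+⟩ (24 * 28) ⟨∙⟩ (𝐃 (𝐃 (𝐃 S₁)) ⟨*⟩ S₃))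
    n (reshape-iv (14 ÷ 5) (12 ÷ 5) (21 ÷ 5) (24 * 28) n 1≤n)
  , τ-expression ((5 ÷ 12) ⟨∙⟩ 𝐃 S₁ ⟨+⟩ (25 ÷ 24) ⟨∙⟩ 𝐃 S₇ ⟨+⟩ (- (11 ÷ 24)) ⟨∙⟩ 𝐃 S₉ ⟨+⟩ 25 ⟨∙⟩ (9 ⟨∙⟩ (𝐃 S₁ ⟨*⟩ S₇) ⟨+⟩ (- 1) ⟨∙⟩ 𝐃 (S₁ ⟨*⟩ S₇)))
    n (reshape-v (5 ÷ 12) (25 ÷ 24) (11 ÷ 24) 25 9 n 1≤n)
  , τ-expression ((9 ÷ 14) ⟨∙⟩ 𝐃 (𝐃 S₁) ⟨+⟩ (5 ÷ 14) ⟨∙⟩ 𝐃 (𝐃 S₇) ⟨+⟩ (- 108) ⟨∙⟩ (4 ⟨∙⟩ (𝐃 (𝐃 S₁) ⟨*⟩ S₅) ⟨+⟩ (- 1) ⟨∙⟩ 𝐃 (𝐃 S₁ ⟨*⟩ S₅)))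
    n (reshape-vi (9 ÷ 14) (5 ÷ 14) 108 4 n 1≤n)
  , τ-expression ((8 ÷ 5) ⟨∙⟩ 𝐃 (𝐃 (𝐃 S₁)) ⟨+⟩ (- (3 ÷ 5)) ⟨∙⟩ 𝐃 (𝐃 (𝐃 S₅)) ⟨+⟩ 96 ⟨∙⟩ (7 ⟨∙⟩ (𝐃 (𝐃 (𝐃 S₁)) ⟨*⟩ S₃) ⟨+⟩ (- 3) ⟨∙⟩ 𝐃 (𝐃 (𝐃 S₁) ⟨*⟩ S₃)))
    n (reshape-vii (8 ÷ 5) (3 ÷ 5) 96 7 3 n 1≤n)
  , τ-expression ((1 ÷ 2) ⟨∙⟩ 𝐃 (𝐃 S₁) ⟨+⟩ (1 ÷ 2) ⟨∙⟩ 𝐃 (𝐃 S₅) ⟨+⟩ (- 12) ⟨∙⟩ (36 ⟨∙⟩ (𝐃 (𝐃 S₁) ⟨*⟩ S₅) ⟨+⟩ (- 16) ⟨∙⟩ 𝐃 (𝐃 S₁ ⟨*⟩ S₅) ⟨+⟩ 𝐃 (𝐃 (S₁ ⟨*⟩ S₅))))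
    n (reshape-viii (1 ÷ 2) (1 ÷ 2) 12 36 16 n 1≤n)
  , τ-expression (𝐃 (𝐃 (𝐃 S₁)) ⟨+⟩ (- 24) ⟨∙⟩ (21 ⟨∙⟩ 𝐃 (𝐃 (𝐃 S₁) ⟨*⟩ S₃) ⟨+⟩ (- 28) ⟨∙⟩ (𝐃 (𝐃 (𝐃 S₁)) ⟨*⟩ S₃) ⟨+⟩ (- 3) ⟨∙⟩ 𝐃 (𝐃 (𝐃 S₁ ⟨*⟩ S₃))))
    n (reshape-ix 24 21 28 3 n 1≤n)
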